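{- Let $n\geq 4$. If $\mathsf r:\phi\to\psi$ is a constant-free, negation-free, non-trivial linear inference that is $M_{\leq n}$-derivable with units, then $\mathsf r$ is also $M_{\leq n}$-derivable without units, i.e. $\phi\overset{*}{\rightsquigarrow}_{M_{\leq n}}\psi$.
   Context: Fix a countably infinite set of variables. Linear formulae on a finite set $\mathcal{V}$ of variables are defined inductively: - $\top,\bot$ are linear formulae on $\emptyset$. - $x,\neg x$ are linear formulae on $\{x\}$. - If $\phi$ is on $\mathcal{V}_1$, $\psi$ is on $\mathcal{V}_2$ and $\mathcal{V}_1\cap\mathcal{V}_2=\emptyset$, then $\phi\lor\psi$ and $\phi\land\psi$ are on $\mathcal{V}_1\cup\mathcal{V}_2$. A formula is constant-free if it contains no $\top,\bot$, and negation-free if it contains no $\neg x$. A linear inference $\phi\to\psi$ is a pair of linear formulae such that every Boolean assignment satisfying $\phi$ satisfies $\psi$. Its variables are those occurring in $\phi$ or $\psi$. $L_{\leq n}$ is the set of linear inferences on at most $n$ variables, $L_n$ those on exactly $n$ variables, and $L_{<n}=L_{\leq n-1}$. An inference $\phi\to\psi$ is trivial at $x$ if $\phi[\top/x]\to\psi[\bot/x]$ is valid; it is non-trivial if it is trivial at no variable. A congruence is an equivalence relation closed under $\land$- and $\lor$-contexts. - $\sim_{\mathsf{ac}}$ is the smallest congruence containing commutativity and associativity of $\land,\lor$. - $\sim_{\mathsf{u}}$ is the smallest congruence containing $\phi\land\top\sim\phi$, $\top\land\phi\sim\phi$, $\phi\lor\bot\sim\phi$, $\bot\lor\phi\sim\phi$,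 $\phi\land\bot\sim\bot$, $\bot\land\phi\sim\bot$, $\phi\lor\top\sim\top$, $\top\lor\phi\sim\top$. - $\sim_{\mathsf{acu}}$ is the smallest congruence containing both. For a set $S$ of linear inferences, $\to_S$ is the smallest relation containing $S$ and closed under substitution (of linear formulae for variables, keeping linearity) and contexts. - $\phi\rightsquigarrow_S\psi$ means $\phi\sim_{\mathsf{ac}}\phi'\to_S\psi'\sim_{\mathsf{ac}}\psi$; its reflexive-transitive closure together with $\sim_{\mathsf{ac}}$, written $\overset{*}{\rightsquigarrow}_S$, is $S$-derivability without units. - $\phi\rightsquigarrow_{S\mathsf u}\psi$ means $\phi\sim_{\mathsf{acu}}\phi'\to_S\psi'\sim_{\mathsf{acu}}\psi$; the reflexive-transitive closure of $\rightsquigarrow_{S\mathsf u}\cup\sim_{\mathsf{acu}}$ is $S$-derivability with units. For $n>4$, a set $X$ is $n$-minimal if it is a smallest set of linear inferences such that $X\cup L_{<n}$ derives with units every $\mathsf r\in L_n$. Such sets are unique up to $\sim_{\mathsf{acu}}$ and renaming of variables, and can be chosen to consist of constant-free negation-free inferences. Define $M_0=M_1=M_2=\emptyset$, $M_3=\{\mathsf s\}$ where $\mathsf s$ is switch $x\land(y\lor z)\to(x\land y)\lor z$, and $M_4=\{\mathsf m\}$ where $\mathsf m$ is medial $(w\land x)\lor(y\land z)\to(w\lor y)\land(x\lor z)$. For $n>4$, $M_n$ is the (unique up to $\sim_{\mathsf{ac}}$ and renaming) constant-free negation-free $n$-minimal set. Finally $M_{\leq n}=\bigcup_{m\leq n}M_m$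 and $M_{<n}=M_{\leq n-1}$. -}

module Defs where

open import Data.Bool as 𝔹 using (Bool; true; false; not; if_then_else_)
open import Data.List using (List; []; _∷_; [_]; _++_; length; deduplicate)
open import Data.List.Membership.Propositional using (_∈_)
open import Data.List.Relation.Binary.Disjoint.Propositional using (Disjoint)
open import Data.List.Relation.Unary.All using (All)
open import Data.Nat using (ℕ; _≤_; _<_; _≟_)
open import Data.Product using (_×_; ∃-syntax)
open import Level using (0ℓ)
open import Relation.Binary.Construct.Closure.ReflexiveTransitive using (Star)
open import Relation.Binary.Construct.Union using () renaming (_∪_ to _∪₂_)
open import Relation.Binary.Core using (Rel)
open import Relation.Binary.PropositionalEquality using (_≡_)
open import Relation.Nullary using (¬_; does)
open import Relation.Unary using (Pred; _∪_)

infixr 7 _∧_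
infixr 6 _∨_
infix  4 _⇒_

Var : Set
Var = ℕ

data Formula : Set where
  ⊤ ⊥     : Formula
  var neg : Var → Formula
  _∧_ _∨_ : Formula → Formula → Formula

vars : Formula → List Var
vars ⊤       = []
vars ⊥       = []
vars (var x) = [ x ]
vars (neg x) = [ x ]
vars (φ ∧ ψ) = vars φ ++ vars ψ
vars (φ ∨ ψ) = vars φ ++ vars ψ

-- The set 𝒱 that a linear formula φ is "on" is determined by φ: it is the set
-- of members of vars φ, so it is not carried as an index.
data Linear : Formula → Set where
  ⊤   : Linear ⊤
  ⊥   : Linear ⊥
  var : ∀ x → Linear (var x)
  neg : ∀ x → Linear (neg x)
  and : ∀ {φ ψ} → Linear φ → Linear ψ → Disjoint (vars φ) (vars ψ) → Linear (φ ∧ ψ)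
  or  : ∀ {φ ψ} → Linear φ → Linear ψ → Disjoint (vars φ) (vars ψ) → Linear (φ ∨ ψ)

data ConstantFree : Formula → Set where
  var : ∀ x → ConstantFree (var x)
  neg : ∀ x → ConstantFree (neg x)
  and : ∀ {φ ψ} → ConstantFree φ → ConstantFree ψ → ConstantFree (φ ∧ ψ)
  or  : ∀ {φ ψ} → ConstantFree φ → ConstantFree ψ → ConstantFree (φ ∨ ψ)

data NegationFree : Formula → Set where
  ⊤   : NegationFree ⊤
  ⊥   : NegationFree ⊥
  var : ∀ x → NegationFree (var x)
  and : ∀ {φ ψ} → NegationFree φ → NegationFree ψ → NegationFree (φ ∧ ψ)
  or  : ∀ {φ ψ} → NegationFree φ → NegationFree ψ → NegationFree (φ ∨ ψ)

-- Negation is primitive on variables only, so a formula substituted for x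
-- replaces neg x by its De Morgan dual.
dual : Formula → Formula
dual ⊤       = ⊥
dual ⊥       = ⊤
dual (var x) = neg x
dual (neg x) = var x
dual (φ ∧ ψ) = dual φ ∨ dual ψ
dual (φ ∨ ψ) = dual φ ∧ dual ψ

Subst : Set
Subst = Var → Formula

_⟪_⟫ : Formula → Subst → Formula
⊤       ⟪ σ ⟫ = ⊤
⊥       ⟪ σ ⟫ = ⊥
var x   ⟪ σ ⟫ = σ x
neg x   ⟪ σ ⟫ = dual (σ x)
(φ ∧ ψ) ⟪ σ ⟫ = φ ⟪ σ ⟫ ∧ ψ ⟪ σ ⟫
(φ ∨ ψ) ⟪ σ ⟫ = φ ⟪ σ ⟫ ∨ ψ ⟪ σ ⟫

_[_/_] : Formula → Formula → Var → Formula
φ [ χ / x ] = φ ⟪ (λ y → if does (y ≟ x) then χ else var y) ⟫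

Assignment : Set
Assignment = Var → Bool

eval : Assignment → Formula → Bool
eval ρ ⊤       = true
eval ρ ⊥       = false
eval ρ (var x) = ρ x
eval ρ (neg x) = not (ρ x)
eval ρ (φ ∧ ψ) = eval ρ φ 𝔹.∧ eval ρ ψ
eval ρ (φ ∨ ψ) = eval ρ φ 𝔹.∨ eval ρ ψ

record Inference : Set where
  constructor _⇒_
  field
    premise    : Formula
    conclusion : Formula
open Inference public

Valid : Inference → Set
Valid (φ ⇒ ψ) = ∀ ρ → eval ρ φ ≡ true → eval ρ ψ ≡ true

record LinearInference (r : Inference) : Set where
  field
    premise-linear    : Linear (premise r)
    conclusion-linear : Linear (conclusion r)
    valid             : Valid r

ivars : Inference → List Var
ivars (φ ⇒ ψ) = deduplicate _≟_ (vars φ ++ vars ψ)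

L : ℕ → Pred Inference 0ℓ
L n r = LinearInference r × length (ivars r) ≡ n

L< : ℕ → Pred Inference 0ℓ
L< n r = LinearInference r × length (ivars r) < n

ConstantFreeInf NegationFreeInf : Pred Inference 0ℓ
ConstantFreeInf (φ ⇒ ψ) = ConstantFree φ × ConstantFree ψ
NegationFreeInf (φ ⇒ ψ) = NegationFree φ × NegationFree ψ

TrivialAt : Var → Pred Inference 0ℓ
TrivialAt x (φ ⇒ ψ) = Valid (φ [ ⊤ / x ] ⇒ ψ [ ⊥ / x ])

-- Only the variables of r count: a valid inference satisfies TrivialAt x for
-- every x that does not occur in it.
NonTrivial : Pred Inference 0ℓ
NonTrivial r = ∀ x → x ∈ ivars r → ¬ TrivialAt x r

-- Congruences and rewriting live on linear formulae, so every formula that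
-- appears in them, including intermediate ones, is required to be linear.
data Cong (R : Rel Formula 0ℓ) : Rel Formula 0ℓ where
  base  : ∀ {φ ψ} → Linear φ → Linear ψ → R φ ψ → Cong R φ ψ
  refl  : ∀ {φ} → Linear φ → Cong R φ φ
  sym   : ∀ {φ ψ} → Cong R φ ψ → Cong R ψ φ
  trans : ∀ {φ ψ χ} → Cong R φ ψ → Cong R ψ χ → Cong R φ χ
  ∧ˡ    : ∀ {φ ψ χ} → Cong R φ ψ → Linear (φ ∧ χ) → Linear (ψ ∧ χ) → Cong R (φ ∧ χ) (ψ ∧ χ)
  ∧ʳ    : ∀ {φ ψ χ} → Cong R φ ψ → Linear (χ ∧ φ) → Linear (χ ∧ ψ) → Cong R (χ ∧ φ) (χ ∧ ψ)
  ∨ˡ    : ∀ {φ ψ χ} → Cong R φ ψ → Linear (φ ∨ χ) → Linear (ψ ∨ χ) → Cong R (φ ∨ χ) (ψ ∨ χ)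
  ∨ʳ    : ∀ {φ ψ χ} → Cong R φ ψ → Linear (χ ∨ φ) → Linear (χ ∨ ψ) → Cong R (χ ∨ φ) (χ ∨ ψ)

data AC : Rel Formula 0ℓ where
  ∧-comm  : ∀ φ ψ → AC (φ ∧ ψ) (ψ ∧ φ)
  ∨-comm  : ∀ φ ψ → AC (φ ∨ ψ) (ψ ∨ φ)
  ∧-assoc : ∀ φ ψ χ → AC ((φ ∧ ψ) ∧ χ) (φ ∧ (ψ ∧ χ))
  ∨-assoc : ∀ φ ψ χ → AC ((φ ∨ ψ) ∨ χ) (φ ∨ (ψ ∨ χ))

data U : Rel Formula 0ℓ where
  ∧⊤ : ∀ φ → U (φ ∧ ⊤) φ
  ⊤∧ : ∀ φ → U (⊤ ∧ φ) φ
  ∨⊥ : ∀ φ → U (φ ∨ ⊥) φ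
  ⊥∨ : ∀ φ → U (⊥ ∨ φ) φ
  ∧⊥ : ∀ φ → U (φ ∧ ⊥) ⊥
  ⊥∧ : ∀ φ → U (⊥ ∧ φ) ⊥
  ∨⊤ : ∀ φ → U (φ ∨ ⊤) ⊤
  ⊤∨ : ∀ φ → U (⊤ ∨ φ) ⊤

_∼ac_ _∼u_ _∼acu_ : Rel Formula 0ℓ
_∼ac_  = Cong AC
_∼u_   = Cong U
_∼acu_ = Cong (_∼ac_ ∪₂ _∼u_)

-- Linearity of φ ⟪ σ ⟫ makes σ x linear for every x occurring in φ.
data Step (S : Pred Inference 0ℓ) : Rel Formula 0ℓ where
  rule  : ∀ {φ ψ} → S (φ ⇒ ψ) → Step S φ ψ
  subst : ∀ {φ ψ} σ → Step S φ ψ → Linear (φ ⟪ σ ⟫) → Linear (ψ ⟪ σ ⟫) →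
          Step S (φ ⟪ σ ⟫) (ψ ⟪ σ ⟫)
  ∧ˡ    : ∀ {φ ψ χ} → Step S φ ψ → Linear (φ ∧ χ) → Linear (ψ ∧ χ) → Step S (φ ∧ χ) (ψ ∧ χ)
  ∧ʳ    : ∀ {φ ψ χ} → Step S φ ψ → Linear (χ ∧ φ) → Linear (χ ∧ ψ) → Step S (χ ∧ φ) (χ ∧ ψ)
  ∨ˡ    : ∀ {φ ψ χ} → Step S φ ψ → Linear (φ ∨ χ) → Linear (ψ ∨ χ) → Step S (φ ∨ χ) (ψ ∨ χ)
  ∨ʳ    : ∀ {φ ψ χ} → Step S φ ψ → Linear (χ ∨ φ) → Linear (χ ∨ ψ) → Step S (χ ∨ φ) (χ ∨ ψ)

Rewrite RewriteU : Pred Inference 0ℓ → Rel Formula 0ℓ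
Rewrite  S φ ψ = ∃[ φ′ ] ∃[ ψ′ ] (φ ∼ac φ′ × Step S φ′ ψ′ × ψ′ ∼ac ψ)
RewriteU S φ ψ = ∃[ φ′ ] ∃[ ψ′ ] (φ ∼acu φ′ × Step S φ′ ψ′ × ψ′ ∼acu ψ)

Derivable DerivableWithUnits : Pred Inference 0ℓ → Pred Inference 0ℓ
Derivable          S (φ ⇒ ψ) = Star (Rewrite  S ∪₂ _∼ac_) φ ψ
DerivableWithUnits S (φ ⇒ ψ) = Star (RewriteU S ∪₂ _∼acu_) φ ψ

Generates : ℕ → List Inference → Set
Generates n X = ∀ r → L n r → DerivableWithUnits ((_∈ X) ∪ L< n) r

-- "Smallest" is by cardinality, among sets of inferences on exactly n
-- variables.  Without the bound on variables the notion would degenerate: a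
-- conjunction of variable-disjoint non-trivial inferences derives each conjunct
-- using units, so one large inference could replace any finite set.  Lists lose no
-- generality: up to ∼acu and renaming L n is finite, so a smallest set is
-- finite and, having minimal length, is listed without repetition.
record Minimal (n : ℕ) (X : List Inference) : Set where
  field
    on-n      : All (L n) X
    generates : Generates n X
    smallest  : ∀ Y → All (L n) Y → Generates n Y → length X ≤ length Y

switch medial : Inference
switch = var 0 ∧ (var 1 ∨ var 2) ⇒ (var 0 ∧ var 1) ∨ var 2
medial = (var 0 ∧ var 1) ∨ (var 2 ∧ var 3) ⇒ (var 0 ∨ var 2) ∧ (var 1 ∨ var 3)

-- The sets M n for n > 4 are only determined up to ∼ac and renaming; this
-- predicate describes the admissible choices of the whole family.
record MinimalFamily (M : ℕ → List Inference) : Set where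
  field
    M₀  : M 0 ≡ []
    M₁  : M 1 ≡ []
    M₂  : M 2 ≡ []
    M₃  : M 3 ≡ [ switch ]
    M₄  : M 4 ≡ [ medial ]
    M>4 : ∀ n → 4 < n → Minimal n (M n) × All ConstantFreeInf (M n) × All NegationFreeInf (M n)

M≤ : (ℕ → List Inference) → ℕ → Pred Inference 0ℓ
M≤ M n r = ∃[ m ] (m ≤ n × r ∈ M m)

{-# OPTIONS --safe #-}

-- Read the formulae of a derivation with units through their unit normal forms,
-- with every variable foreign to r set to ⊤.  Because r is trivial nowhere, each
-- of these normal forms is a negation-free formula on exactly the variables of r:
-- a constant, a lost variable or a negative occurrence would make r trivial
-- there.  A step by a rule then becomes, inside a unit-free context, a
-- substitution instance of the rule with some of its variables set to units.  If
-- no variable is, the step is a step without units; otherwise the instantiated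
-- rule is again non-trivial and has fewer variables, so it is derivable without
-- units by induction on their number: n-minimality supplies a derivation with
-- units to which the same argument applies, and at most four variables leave
-- finitely many inferences up to renaming and AC, checked by computation.
module Submission where

open import Data.Bool as 𝔹 using (Bool; true; false; not; if_then_else_; T; T?)
open import Data.Bool.ListAction using (any; all)
open import Data.Bool.Properties as 𝔹ₚ using (T-≡; T-∧; T-∨)
open import Data.Empty using (⊥-elim)
open import Data.List using (List; []; _∷_; [_]; _++_; length; concatMap; map; deduplicate; upTo)
open import Data.List.Membership.Propositional using (_∈_; _∉_; find)
open import Data.List.Membership.Propositional.Properties
open import Data.List.Properties
  using (concatMap-++; length-++; length-map; length-upTo; map-++; ++-identityʳ; ++-conicalˡ; ++-conicalʳ)
open import Data.List.Relation.Binary.Disjoint.Propositional using (Disjoint)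
open import Data.List.Relation.Binary.Permutation.Propositional
  using (_↭_; ↭-refl; ↭-sym; ↭-trans; ↭-prep; ↭-reflexive; ↭⇒↭ₛ; module PermutationReasoning)
  renaming (refl to ↭refl; prep to ↭prep; swap to ↭swap; trans to ↭trans)
import Data.List.Relation.Binary.Permutation.Propositional.Properties as ↭
import Data.List.Relation.Binary.Permutation.Setoid.Properties as PermSetoid
open import Data.List.Relation.Binary.Subset.Propositional using (_⊆_)
open import Data.List.Relation.Unary.All as All using (All; []; _∷_)
import Data.List.Relation.Unary.All.Properties as All
open import Data.List.Relation.Unary.AllPairs using ([]; _∷_)
open import Data.List.Relation.Unary.Any as Any using (here; there)
import Data.List.Relation.Unary.Any.Properties as Any
open import Data.List.Relation.Unary.Unique.Propositional using (Unique)
import Data.List.Relation.Unary.Unique.Propositional.Properties as Unique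
open import Data.Nat using (ℕ; zero; suc; _≤_; _<_; _≟_; _+_; z≤n; s≤s; _≡ᵇ_) renaming (_≤ᵇ_ to _≤?ᵇ_)
open import Data.Nat.Induction using (<-rec)
import Data.Nat.Properties as ℕ
open import Data.List.Membership.DecPropositional _≟_ using (_∈?_)
open import Data.List.Relation.Unary.Unique.DecPropositional _≟_ using (unique?)
open import Data.List.Relation.Unary.Unique.DecPropositional.Properties _≟_ using (deduplicate-!)
open import Data.Product using (_×_; _,_; ∃-syntax; proj₁; proj₂)
open import Data.Sum as Sum using (_⊎_; inj₁; inj₂; [_,_]′)
open import Data.Unit using (tt)
open import Function using (_∘_; id; case_of_)
open import Function.Bundles using (Equivalence)
open import Level using (0ℓ)
open import Relation.Binary.Construct.Closure.ReflexiveTransitive using (Star; ε; _◅_; _◅◅_)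
open import Relation.Binary.Construct.Union using () renaming (_∪_ to _∪₂_)
open import Relation.Binary.Core using (Rel)
open import Relation.Binary.Definitions using (DecidableEquality)
import Relation.Binary.PropositionalEquality as ≡
open import Relation.Nullary using (¬_; Dec; does; yes; no)
open import Relation.Nullary.Decidable using (dec-true; dec-false; from-yes; map′; _×-dec_)
open import Relation.Unary using (Pred)
open import Defs

-- The obstacle is that `⊥` is equivalent to `φ ∧ ⊥` for every `φ`: a derivation with units may
-- bring in arbitrary subformulae, negations and new variables. Semantics controls what syntax does
-- not. Every step is sound, so each intermediate formula lies between the two sides of r, and a
-- triviality of any implication inside this interval would be one of r. The second transfer runs
-- along substitutions: if a negation-free rule is trivial at x, a linear instance is trivial at
-- each variable of the formula put for x, because linearity confines that variable to this formula.
-- So the rule behind a non-trivial step is itself non-trivial. The same elimination is run on two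
-- rule sets: on M k together with all inferences on fewer than k variables, inside the induction,
-- and on the family up to n, for the theorem. Inferences on fewer variables may contain units and
-- negations; they are never copied into the result, but their instantiated forms are derived by
-- induction. Four is the threshold because up to there the family is given explicitly, by switch
-- and medial, and no minimality can be invoked.

open ≡ using (_≡_; _≢_; refl)
open Equivalence using (to; from)

-- Lists without repetition

++-unique⁻ : ∀ (xs : List Var) {ys} → Unique (xs ++ ys) → Unique xs × Unique ys × Disjoint xs ys
++-unique⁻ []       u        = [] , u , λ { (() , _) }
++-unique⁻ (x ∷ xs) (x∉ ∷ u) with uxs , uys , dis ← ++-unique⁻ xs u =
  All.++⁻ˡ xs x∉ ∷ uxs , uys , λ where
    (here refl , q) → All.lookup x∉ (∈-++⁺ʳ xs q) refl
    (there p   , q) → dis (p , q)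

Unique-resp-↭ : {xs ys : List Var} → xs ↭ ys → Unique xs → Unique ys
Unique-resp-↭ p = PermSetoid.Unique-resp-↭ (≡.setoid Var) (↭⇒↭ₛ p)

⊆-complement : {xs ys : List Var} → Unique xs → xs ⊆ ys → ∃[ zs ] ys ↭ xs ++ zs
⊆-complement {[]}     {ys} _        _  = ys , ↭-refl
⊆-complement {x ∷ xs}      (x∉ ∷ u) xs⊆ with as , bs , refl ← ∈-∃++ (xs⊆ (here refl)) =
  let zs , p = ⊆-complement {xs} {as ++ bs} u λ {y} y∈ → drop-x y∈ (∈-++⁻ as (xs⊆ (there y∈)))
  in zs , ↭-trans (↭.shift x as bs) (↭-prep x p)
  where
  drop-x : ∀ {y} → y ∈ xs → y ∈ as ⊎ y ∈ x ∷ bs → y ∈ as ++ bs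
  drop-x y∈ (inj₁ q)           = ∈-++⁺ˡ q
  drop-x y∈ (inj₂ (here refl)) = ⊥-elim (All.lookup x∉ y∈ refl)
  drop-x y∈ (inj₂ (there q))   = ∈-++⁺ʳ as q

⊆-length : {xs ys : List Var} → Unique xs → xs ⊆ ys → length xs ≤ length ys
⊆-length {xs} {ys} u xs⊆ with zs , p ← ⊆-complement u xs⊆ = begin
  length xs               ≤⟨ ℕ.m≤m+n _ _ ⟩
  length xs + length zs   ≡⟨ length-++ xs ⟨
  length (xs ++ zs)       ≡⟨ ↭.↭-length p ⟨
  length ys               ∎
  where open ℕ.≤-Reasoning

⊆-length-< : ∀ {xs ys : List Var} {y} → Unique xs → xs ⊆ ys → y ∈ ys → y ∉ xs → length xs < length ys
⊆-length-< u xs⊆ y∈ y∉ = ⊆-length (All.tabulate (λ { q refl → y∉ q }) ∷ u) λ where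
  (here refl) → y∈
  (there q)   → xs⊆ q

⊆⊇⇒↭ : {xs ys : List Var} → Unique xs → Unique ys → xs ⊆ ys → ys ⊆ xs → xs ↭ ys
⊆⊇⇒↭ {xs} ux uy xs⊆ ys⊆ with ⊆-complement ux xs⊆
... | []     , p = ↭-sym (↭-trans p (↭-reflexive (++-identityʳ xs)))
 
... | z ∷ zs , p with _ , _ , dis ← ++-unique⁻ xs (Unique-resp-↭ p uy) =
  ⊥-elim (dis (ys⊆ (↭.∈-resp-↭ (↭-sym p) (∈-++⁺ʳ xs (here refl))) , here refl))

⊆-length⇒↭ : {xs ys : List Var} → Unique xs → Unique ys → xs ⊆ ys → length ys ≤ length xs → xs ↭ ys
⊆-length⇒↭ {xs} {ys} ux uy xs⊆ len = ⊆⊇⇒↭ ux uy xs⊆ λ {y} y∈ → case y ∈? xs of λ where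
  (yes q) → q
  (no  q) → ⊥-elim (ℕ.<⇒≱ (⊆-length-< ux xs⊆ y∈ q) len)

concatMap-↭ : ∀ (f : Var → List Var) {xs ys} → xs ↭ ys → concatMap f xs ↭ concatMap f ys
concatMap-↭ f ↭refl         = ↭-refl
concatMap-↭ f (↭prep x p)   = ↭.++⁺ˡ (f x) (concatMap-↭ f p)
concatMap-↭ f (↭swap x y p) = ↭-trans (↭.shifts (f x) (f y)) (↭.++⁺ˡ (f y) (↭.++⁺ˡ (f x) (concatMap-↭ f p)))
concatMap-↭ f (↭trans p q)  = ↭-trans (concatMap-↭ f p) (concatMap-↭ f q)

-- Meant for `f = vars ∘ σ`: in a linear instance a variable occurs in the image of one variable
-- only. This is how linearity enters the transfer of triviality.
concatMap-disjoint : ∀ (f : Var → List Var) {xs x u y} → Unique (concatMap f xs) →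
  x ∈ xs → u ∈ xs → y ∈ f x → y ∈ f u → x ≡ u
concatMap-disjoint f {z ∷ xs} un x∈ u∈ y∈x y∈u with _ , ur , dis ← ++-unique⁻ (f z) un | x∈ | u∈
... | here refl | here refl = refl
... | here refl | there q   = ⊥-elim (dis (y∈x , ∈-concatMap⁺ f (Any.map (λ { refl → y∈u }) q)))
... | there p   | here refl = ⊥-elim (dis (y∈u , ∈-concatMap⁺ f (Any.map (λ { refl → y∈x }) p)))
... | there p   | there q   = concatMap-disjoint f ur p q y∈x y∈u

-- Formulae

data Op : Set where
  conj disj : Op

infixl 7 _⟨_⟩_
_⟨_⟩_ : Formula → Op → Formula → Formula
f ⟨ conj ⟩ g = f ∧ g
f ⟨ disj ⟩ g = f ∨ g

vars-⟨⟩ : ∀ o {f g} → vars (f ⟨ o ⟩ g) ≡ vars f ++ vars g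
vars-⟨⟩ conj = refl
vars-⟨⟩ disj = refl

Linear⇒Unique : ∀ {f} → Linear f → Unique (vars f)
Linear⇒Unique ⊤           = []
Linear⇒Unique ⊥           = []
Linear⇒Unique (var x)     = [] ∷ []
Linear⇒Unique (neg x)     = [] ∷ []
Linear⇒Unique (and l r d) = Unique.++⁺ (Linear⇒Unique l) (Linear⇒Unique r) d
Linear⇒Unique (or l r d)  = Unique.++⁺ (Linear⇒Unique l) (Linear⇒Unique r) d

Unique⇒Linear : ∀ f → Unique (vars f) → Linear f
Unique⇒Linear ⊤       _ = ⊤
Unique⇒Linear ⊥       _ = ⊥
Unique⇒Linear (var x) _ = var x
Unique⇒Linear (neg x) _ = neg x
Unique⇒Linear (f ∧ g) u with uf , ug , d ← ++-unique⁻ (vars f) u = and (Unique⇒Linear f uf) (Unique⇒Linear g ug) d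
Unique⇒Linear (f ∨ g) u with uf , ug , d ← ++-unique⁻ (vars f) u = or (Unique⇒Linear f uf) (Unique⇒Linear g ug) d

Linear-resp-↭ : ∀ {f g} → vars f ↭ vars g → Linear f → Linear g
Linear-resp-↭ p l = Unique⇒Linear _ (Unique-resp-↭ p (Linear⇒Unique l))

Linear-⟨⟩⁻ : ∀ o {f g} → Linear (f ⟨ o ⟩ g) → Linear f × Linear g × Disjoint (vars f) (vars g)
Linear-⟨⟩⁻ conj (and l r d) = l , r , d
Linear-⟨⟩⁻ disj (or l r d)  = l , r , d

vars-dual : ∀ f → vars (dual f) ≡ vars f
vars-dual ⊤       = refl
vars-dual ⊥       = refl
vars-dual (var x) = refl
vars-dual (neg x) = refl
vars-dual (f ∧ g) = ≡.cong₂ _++_ (vars-dual f) (vars-dual g)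
vars-dual (f ∨ g) = ≡.cong₂ _++_ (vars-dual f) (vars-dual g)

dual-involutive : ∀ f → dual (dual f) ≡ f
dual-involutive ⊤       = refl
dual-involutive ⊥       = refl
dual-involutive (var x) = refl
dual-involutive (neg x) = refl
dual-involutive (f ∧ g) = ≡.cong₂ _∧_ (dual-involutive f) (dual-involutive g)
dual-involutive (f ∨ g) = ≡.cong₂ _∨_ (dual-involutive f) (dual-involutive g)

dual-⟪⟫ : ∀ f σ → dual (f ⟪ σ ⟫) ≡ dual f ⟪ σ ⟫
dual-⟪⟫ ⊤       σ = refl
dual-⟪⟫ ⊥       σ = refl
dual-⟪⟫ (var x) σ = refl
dual-⟪⟫ (neg x) σ = dual-involutive (σ x)
dual-⟪⟫ (f ∧ g) σ = ≡.cong₂ _∨_ (dual-⟪⟫ f σ) (dual-⟪⟫ g σ)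
dual-⟪⟫ (f ∨ g) σ = ≡.cong₂ _∧_ (dual-⟪⟫ f σ) (dual-⟪⟫ g σ)

⟪⟫-⟪⟫ : ∀ f σ τ → (f ⟪ σ ⟫) ⟪ τ ⟫ ≡ f ⟪ (λ x → σ x ⟪ τ ⟫) ⟫
⟪⟫-⟪⟫ ⊤       σ τ = refl
⟪⟫-⟪⟫ ⊥       σ τ = refl
⟪⟫-⟪⟫ (var x) σ τ = refl
⟪⟫-⟪⟫ (neg x) σ τ = ≡.sym (dual-⟪⟫ (σ x) τ)
⟪⟫-⟪⟫ (f ∧ g) σ τ = ≡.cong₂ _∧_ (⟪⟫-⟪⟫ f σ τ) (⟪⟫-⟪⟫ g σ τ)
⟪⟫-⟪⟫ (f ∨ g) σ τ = ≡.cong₂ _∨_ (⟪⟫-⟪⟫ f σ τ) (⟪⟫-⟪⟫ g σ τ)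

⟪⟫-id : ∀ {f σ} → (∀ {x} → x ∈ vars f → σ x ≡ var x) → f ⟪ σ ⟫ ≡ f
⟪⟫-id {⊤}     _ = refl
⟪⟫-id {⊥}     _ = refl
⟪⟫-id {var x} h = h (here refl)
⟪⟫-id {neg x} h = ≡.cong dual (h (here refl))
⟪⟫-id {f ∧ g} h = ≡.cong₂ _∧_ (⟪⟫-id (h ∘ ∈-++⁺ˡ)) (⟪⟫-id (h ∘ ∈-++⁺ʳ (vars f)))
⟪⟫-id {f ∨ g} h = ≡.cong₂ _∨_ (⟪⟫-id (h ∘ ∈-++⁺ˡ)) (⟪⟫-id (h ∘ ∈-++⁺ʳ (vars f)))

vars-⟪⟫ : ∀ f σ → vars (f ⟪ σ ⟫) ≡ concatMap (vars ∘ σ) (vars f)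
vars-⟪⟫ ⊤       σ = refl
vars-⟪⟫ ⊥       σ = refl
vars-⟪⟫ (var x) σ = ≡.sym (++-identityʳ _)
vars-⟪⟫ (neg x) σ = ≡.trans (vars-dual (σ x)) (≡.sym (++-identityʳ _))
vars-⟪⟫ (f ∧ g) σ = ≡.trans (≡.cong₂ _++_ (vars-⟪⟫ f σ) (vars-⟪⟫ g σ)) (≡.sym (concatMap-++ (vars ∘ σ) (vars f) (vars g)))
vars-⟪⟫ (f ∨ g) σ = ≡.trans (≡.cong₂ _++_ (vars-⟪⟫ f σ) (vars-⟪⟫ g σ)) (≡.sym (concatMap-++ (vars ∘ σ) (vars f) (vars g)))

∈-vars-⟪⟫⁺ : ∀ {f σ x y} → x ∈ vars f → y ∈ vars (σ x) → y ∈ vars (f ⟪ σ ⟫)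
∈-vars-⟪⟫⁺ {f} {σ} x∈ y∈ rewrite vars-⟪⟫ f σ = ∈-concatMap⁺ (vars ∘ σ) (Any.map (λ { refl → y∈ }) x∈)

-- Assignments and evaluation

infix 8 _[_≔_]
_[_≔_] : Assignment → Var → Bool → Assignment
(ρ [ x ≔ b ]) y = if does (y ≟ x) then b else ρ y

update-same : ∀ ρ x {b} → (ρ [ x ≔ b ]) x ≡ b
update-same ρ x rewrite dec-true (x ≟ x) refl = refl

update-other : ∀ ρ {x y b} → y ≢ x → (ρ [ x ≔ b ]) y ≡ ρ y
update-other ρ {x} {y} y≢x rewrite dec-false (y ≟ x) y≢x = refl

eval-cong : ∀ {f ρ ρ′} → (∀ {x} → x ∈ vars f → ρ x ≡ ρ′ x) → eval ρ f ≡ eval ρ′ f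
eval-cong {⊤}     h = refl
eval-cong {⊥}     h = refl
eval-cong {var x} h = h (here refl)
eval-cong {neg x} h = ≡.cong not (h (here refl))
eval-cong {f ∧ g} h = ≡.cong₂ 𝔹._∧_ (eval-cong {f} (h ∘ ∈-++⁺ˡ)) (eval-cong {g} (h ∘ ∈-++⁺ʳ (vars f)))
eval-cong {f ∨ g} h = ≡.cong₂ 𝔹._∨_ (eval-cong {f} (h ∘ ∈-++⁺ˡ)) (eval-cong {g} (h ∘ ∈-++⁺ʳ (vars f)))

eval-dual : ∀ f ρ → eval ρ (dual f) ≡ not (eval ρ f)
eval-dual ⊤       ρ = refl
eval-dual ⊥       ρ = refl
eval-dual (var x) ρ = refl
eval-dual (neg x) ρ = ≡.sym (𝔹ₚ.not-involutive (ρ x))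
eval-dual (f ∧ g) ρ rewrite eval-dual f ρ | eval-dual g ρ with eval ρ f
... | true  = refl
... | false = refl
eval-dual (f ∨ g) ρ rewrite eval-dual f ρ | eval-dual g ρ with eval ρ f
... | true  = refl
... | false = refl

eval-⟪⟫ : ∀ f σ ρ → eval ρ (f ⟪ σ ⟫) ≡ eval (λ x → eval ρ (σ x)) f
eval-⟪⟫ ⊤       σ ρ = refl
eval-⟪⟫ ⊥       σ ρ = refl
eval-⟪⟫ (var x) σ ρ = refl
eval-⟪⟫ (neg x) σ ρ = eval-dual (σ x) ρ
eval-⟪⟫ (f ∧ g) σ ρ = ≡.cong₂ 𝔹._∧_ (eval-⟪⟫ f σ ρ) (eval-⟪⟫ g σ ρ)
eval-⟪⟫ (f ∨ g) σ ρ = ≡.cong₂ 𝔹._∨_ (eval-⟪⟫ f σ ρ) (eval-⟪⟫ g σ ρ)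

_≤ᵇ_ : Bool → Bool → Set
a ≤ᵇ b = a ≡ true → b ≡ true

⟦_⟧ : Op → Bool → Bool → Bool
⟦ conj ⟧ = 𝔹._∧_
⟦ disj ⟧ = 𝔹._∨_

eval-⟨⟩ : ∀ o {f g} ρ → eval ρ (f ⟨ o ⟩ g) ≡ ⟦ o ⟧ (eval ρ f) (eval ρ g)
eval-⟨⟩ conj ρ = refl
eval-⟨⟩ disj ρ = refl

⟦⟧-mono : ∀ o {a b c d} → a ≤ᵇ b → c ≤ᵇ d → ⟦ o ⟧ a c ≤ᵇ ⟦ o ⟧ b d
⟦⟧-mono conj {true}          {c = true} p q _ rewrite p refl | q refl = refl
⟦⟧-mono disj {true}                     p q _ rewrite p refl = refl
⟦⟧-mono disj {false} {true}             p q _ = refl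
⟦⟧-mono disj {false} {false}            p q = q

eval-mono : ∀ {f ρ ρ′} → NegationFree f → (∀ {x} → x ∈ vars f → ρ x ≤ᵇ ρ′ x) → eval ρ f ≤ᵇ eval ρ′ f
eval-mono ⊤       h = id
eval-mono ⊥       h = id
eval-mono (var x) h = h (here refl)
eval-mono (and {f} p q) h = ⟦⟧-mono conj (eval-mono p (h ∘ ∈-++⁺ˡ)) (eval-mono q (h ∘ ∈-++⁺ʳ (vars f)))
eval-mono (or  {f} p q) h = ⟦⟧-mono disj (eval-mono p (h ∘ ∈-++⁺ˡ)) (eval-mono q (h ∘ ∈-++⁺ʳ (vars f)))

-- Formulae modulo associativity and commutativity

infix 4 _≈_
-- This is `_∼ac_` with its linearity side conditions dropped. AC steps only permute variables, so
-- linearity of one end spreads to every intermediate formula and `≈⇒∼ac` can restore the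
-- conditions.
data _≈_ : Rel Formula 0ℓ where
  ac    : ∀ {f g} → AC f g → f ≈ g
  refl  : ∀ {f} → f ≈ f
  sym   : ∀ {f g} → f ≈ g → g ≈ f
  trans : ∀ {f g h} → f ≈ g → g ≈ h → f ≈ h
  cong  : ∀ o {f f′ g g′} → f ≈ f′ → g ≈ g′ → f ⟨ o ⟩ g ≈ f′ ⟨ o ⟩ g′

≈-comm : ∀ o f g → f ⟨ o ⟩ g ≈ g ⟨ o ⟩ f
≈-comm conj f g = ac (∧-comm f g)
≈-comm disj f g = ac (∨-comm f g)

≈-assoc : ∀ o f g h → (f ⟨ o ⟩ g) ⟨ o ⟩ h ≈ f ⟨ o ⟩ (g ⟨ o ⟩ h)
≈-assoc conj f g h = ac (∧-assoc f g h)
≈-assoc disj f g h = ac (∨-assoc f g h)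

≈-vars : ∀ {f g} → f ≈ g → vars f ↭ vars g
≈-vars (ac (∧-comm f g))    = ↭.++-comm (vars f) (vars g)
≈-vars (ac (∨-comm f g))    = ↭.++-comm (vars f) (vars g)
≈-vars (ac (∧-assoc f g h)) = ↭.++-assoc (vars f) (vars g) (vars h)
≈-vars (ac (∨-assoc f g h)) = ↭.++-assoc (vars f) (vars g) (vars h)
≈-vars refl                 = ↭-refl
≈-vars (sym p)              = ↭-sym (≈-vars p)
≈-vars (trans p q)          = ↭-trans (≈-vars p) (≈-vars q)
≈-vars (cong conj p q)      = ↭.++⁺ (≈-vars p) (≈-vars q)
≈-vars (cong disj p q)      = ↭.++⁺ (≈-vars p) (≈-vars q)

≈-eval : ∀ {f g} → f ≈ g → ∀ ρ → eval ρ f ≡ eval ρ g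
≈-eval (ac (∧-comm f g))    ρ = 𝔹ₚ.∧-comm (eval ρ f) (eval ρ g)
≈-eval (ac (∨-comm f g))    ρ = 𝔹ₚ.∨-comm (eval ρ f) (eval ρ g)
≈-eval (ac (∧-assoc f g h)) ρ = 𝔹ₚ.∧-assoc (eval ρ f) (eval ρ g) (eval ρ h)
≈-eval (ac (∨-assoc f g h)) ρ = 𝔹ₚ.∨-assoc (eval ρ f) (eval ρ g) (eval ρ h)
≈-eval refl                 ρ = refl
≈-eval (sym p)              ρ = ≡.sym (≈-eval p ρ)
≈-eval (trans p q)          ρ = ≡.trans (≈-eval p ρ) (≈-eval q ρ)
≈-eval (cong conj p q)      ρ = ≡.cong₂ 𝔹._∧_ (≈-eval p ρ) (≈-eval q ρ)
≈-eval (cong disj p q)      ρ = ≡.cong₂ 𝔹._∨_ (≈-eval p ρ) (≈-eval q ρ)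

≈-⟪⟫ : ∀ σ {f g} → f ≈ g → f ⟪ σ ⟫ ≈ g ⟪ σ ⟫
≈-⟪⟫ σ (ac (∧-comm f g))    = ac (∧-comm _ _)
≈-⟪⟫ σ (ac (∨-comm f g))    = ac (∨-comm _ _)
≈-⟪⟫ σ (ac (∧-assoc f g h)) = ac (∧-assoc _ _ _)
≈-⟪⟫ σ (ac (∨-assoc f g h)) = ac (∨-assoc _ _ _)
≈-⟪⟫ σ refl                 = refl
≈-⟪⟫ σ (sym p)              = sym (≈-⟪⟫ σ p)
≈-⟪⟫ σ (trans p q)          = trans (≈-⟪⟫ σ p) (≈-⟪⟫ σ q)
≈-⟪⟫ σ (cong conj p q)      = cong conj (≈-⟪⟫ σ p) (≈-⟪⟫ σ q)
≈-⟪⟫ σ (cong disj p q)      = cong disj (≈-⟪⟫ σ p) (≈-⟪⟫ σ q)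

≈⇒∼ac : ∀ {f g} → Linear f → f ≈ g → f ∼ac g
≈⇒∼ac l p@(ac q)        = base l (Linear-resp-↭ (≈-vars p) l) q
≈⇒∼ac l refl            = refl l
≈⇒∼ac l (sym p)         = sym (≈⇒∼ac (Linear-resp-↭ (↭-sym (≈-vars p)) l) p)
≈⇒∼ac l (trans p q)     = trans (≈⇒∼ac l p) (≈⇒∼ac (Linear-resp-↭ (≈-vars p) l) q)
≈⇒∼ac l pq@(cong conj {g = g} p q) =
  let lf , lg , _ = Linear-⟨⟩⁻ conj l ; m = Linear-resp-↭ (↭.++⁺ʳ (vars g) (≈-vars p)) l in
  trans (∧ˡ (≈⇒∼ac lf p) l m) (∧ʳ (≈⇒∼ac lg q) m (Linear-resp-↭ (≈-vars pq) l))
≈⇒∼ac l pq@(cong disj {g = g} p q) =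
  let lf , lg , _ = Linear-⟨⟩⁻ disj l ; m = Linear-resp-↭ (↭.++⁺ʳ (vars g) (≈-vars p)) l in
  trans (∨ˡ (≈⇒∼ac lf p) l m) (∨ʳ (≈⇒∼ac lg q) m (Linear-resp-↭ (≈-vars pq) l))

∼ac⇒≈ : ∀ {f g} → f ∼ac g → f ≈ g
∼ac⇒≈ (base _ _ p) = ac p
∼ac⇒≈ (refl _)     = refl
∼ac⇒≈ (sym p)      = sym (∼ac⇒≈ p)
∼ac⇒≈ (trans p q)  = trans (∼ac⇒≈ p) (∼ac⇒≈ q)
∼ac⇒≈ (∧ˡ p _ _)   = cong conj (∼ac⇒≈ p) refl
∼ac⇒≈ (∧ʳ p _ _)   = cong conj refl (∼ac⇒≈ p)
∼ac⇒≈ (∨ˡ p _ _)   = cong disj (∼ac⇒≈ p) refl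
∼ac⇒≈ (∨ʳ p _ _)   = cong disj refl (∼ac⇒≈ p)

-- Rewriting steps and derivations

data RawStep (S : Pred Inference 0ℓ) : Rel Formula 0ℓ where
  inst : ∀ {l r} → S (l ⇒ r) → ∀ σ → RawStep S (l ⟪ σ ⟫) (r ⟪ σ ⟫)
  ctxˡ : ∀ o {f g h} → RawStep S f g → RawStep S (f ⟨ o ⟩ h) (g ⟨ o ⟩ h)
  ctxʳ : ∀ o {f g h} → RawStep S f g → RawStep S (h ⟨ o ⟩ f) (h ⟨ o ⟩ g)

module _ {S : Pred Inference 0ℓ} where

  -- Substitutions commute with contexts and compose with the one at the rule, so all uses of
  -- `subst` in a `Step` collapse into the single substitution of `inst`. Linearity is not recorded
  -- in between; `RawStep⇒Step` recovers it from the two ends.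
  RawStep-⟪⟫ : ∀ σ {f g} → RawStep S f g → RawStep S (f ⟪ σ ⟫) (g ⟪ σ ⟫)
  RawStep-⟪⟫ σ (inst {l} {r} s τ) =
    ≡.subst₂ (RawStep S) (≡.sym (⟪⟫-⟪⟫ l τ σ)) (≡.sym (⟪⟫-⟪⟫ r τ σ)) (inst s (λ x → τ x ⟪ σ ⟫))
  RawStep-⟪⟫ σ (ctxˡ conj s) = ctxˡ conj (RawStep-⟪⟫ σ s)
  RawStep-⟪⟫ σ (ctxˡ disj s) = ctxˡ disj (RawStep-⟪⟫ σ s)
  RawStep-⟪⟫ σ (ctxʳ conj s) = ctxʳ conj (RawStep-⟪⟫ σ s)
  RawStep-⟪⟫ σ (ctxʳ disj s) = ctxʳ disj (RawStep-⟪⟫ σ s)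

  Step⇒RawStep : ∀ {f g} → Step S f g → RawStep S f g
  Step⇒RawStep (rule {φ} {ψ} s)  =
    ≡.subst₂ (RawStep S) (⟪⟫-id {φ} λ _ → refl) (⟪⟫-id {ψ} λ _ → refl) (inst s var)
  Step⇒RawStep (subst σ s _ _)   = RawStep-⟪⟫ σ (Step⇒RawStep s)
  Step⇒RawStep (∧ˡ s _ _)        = ctxˡ conj (Step⇒RawStep s)
  Step⇒RawStep (∧ʳ s _ _)        = ctxʳ conj (Step⇒RawStep s)
  Step⇒RawStep (∨ˡ s _ _)        = ctxˡ disj (Step⇒RawStep s)
  Step⇒RawStep (∨ʳ s _ _)        = ctxʳ disj (Step⇒RawStep s)

  RawStep⇒Step : ∀ {f g} → Linear f → Linear g → RawStep S f g → Step S f g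
  RawStep⇒Step lf lg (inst s σ) = subst σ (rule s) lf lg
  RawStep⇒Step lf lg (ctxˡ conj s) with a , _ ← Linear-⟨⟩⁻ conj lf | b , _ ← Linear-⟨⟩⁻ conj lg = ∧ˡ (RawStep⇒Step a b s) lf lg
  RawStep⇒Step lf lg (ctxˡ disj s) with a , _ ← Linear-⟨⟩⁻ disj lf | b , _ ← Linear-⟨⟩⁻ disj lg = ∨ˡ (RawStep⇒Step a b s) lf lg
  RawStep⇒Step lf lg (ctxʳ conj s) with _ , a , _ ← Linear-⟨⟩⁻ conj lf | _ , b , _ ← Linear-⟨⟩⁻ conj lg = ∧ʳ (RawStep⇒Step a b s) lf lg
  RawStep⇒Step lf lg (ctxʳ disj s) with _ , a , _ ← Linear-⟨⟩⁻ disj lf | _ , b , _ ← Linear-⟨⟩⁻ disj lg = ∨ʳ (RawStep⇒Step a b s) lf lg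

-- Fixing the set of variables makes derivations closed under every substitution
-- that keeps their first formula linear, which Derivable is not: its steps may
-- introduce or lose variables.
record DStep (S : Pred Inference 0ℓ) (f g : Formula) : Set where
  constructor dstep
  field
    step   : f ≈ g ⊎ RawStep S f g
    linear : Linear f
    same   : vars f ↭ vars g

D : Pred Inference 0ℓ → Rel Formula 0ℓ
D S = Star (DStep S)

module _ {S : Pred Inference 0ℓ} where

  D-≈ : ∀ {f g} → Linear f → f ≈ g → D S f g
  D-≈ l p = dstep (inj₁ p) l (≈-vars p) ◅ ε

  D-vars : ∀ {f g} → D S f g → vars f ↭ vars g
  D-vars ε        = ↭-refl
  D-vars (d ◅ ds) = ↭-trans (DStep.same d) (D-vars ds)

  D⇒Derivable : ∀ {f g} → D S f g → Derivable S (f ⇒ g)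
  D⇒Derivable ε = ε
  D⇒Derivable (dstep (inj₁ p) l _ ◅ ds) = inj₂ (≈⇒∼ac l p) ◅ D⇒Derivable ds
  D⇒Derivable (dstep (inj₂ s) l v ◅ ds) with l′ ← Linear-resp-↭ v l =
    inj₁ (_ , _ , refl l , RawStep⇒Step l l′ s , refl l′) ◅ D⇒Derivable ds

  ⟪⟫-vars-↭ : ∀ σ {f g} → vars f ↭ vars g → vars (f ⟪ σ ⟫) ↭ vars (g ⟪ σ ⟫)
  ⟪⟫-vars-↭ σ {f} {g} p rewrite vars-⟪⟫ f σ | vars-⟪⟫ g σ = concatMap-↭ (vars ∘ σ) p

  D-⟪⟫ : ∀ σ {f g} → Linear (f ⟪ σ ⟫) → D S f g → D S (f ⟪ σ ⟫) (g ⟪ σ ⟫)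
  D-⟪⟫ σ l ε = ε
  D-⟪⟫ σ {f} l (_◅_ {j = h} (dstep s _ v) ds) =
    let v′ = ⟪⟫-vars-↭ σ {f} {h} v
    in dstep (Sum.map (≈-⟪⟫ σ) (RawStep-⟪⟫ σ) s) l v′ ◅ D-⟪⟫ σ {h} (Linear-resp-↭ v′ l) ds

  ⟨⟩-vars-↭ : ∀ o {f f′ g g′} → vars f ↭ vars f′ → vars g ↭ vars g′ → vars (f ⟨ o ⟩ g) ↭ vars (f′ ⟨ o ⟩ g′)
  ⟨⟩-vars-↭ conj = ↭.++⁺
  ⟨⟩-vars-↭ disj = ↭.++⁺

  D-ctxˡ : ∀ o {f g h} → Linear (f ⟨ o ⟩ h) → D S f g → D S (f ⟨ o ⟩ h) (g ⟨ o ⟩ h)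
  D-ctxˡ o l ε = ε
  D-ctxˡ o l (dstep s _ v ◅ ds) =
    let v′ = ⟨⟩-vars-↭ o v ↭-refl
    in dstep (Sum.map (λ p → cong o p refl) (ctxˡ o) s) l v′ ◅ D-ctxˡ o (Linear-resp-↭ v′ l) ds

  D-ctxʳ : ∀ o {f g h} → Linear (h ⟨ o ⟩ f) → D S f g → D S (h ⟨ o ⟩ f) (h ⟨ o ⟩ g)
  D-ctxʳ o l ε = ε
  D-ctxʳ o {h = h} l (dstep s _ v ◅ ds) =
    let v′ = ⟨⟩-vars-↭ o {h} ↭-refl v
    in dstep (Sum.map (cong o refl) (ctxʳ o) s) l v′ ◅ D-ctxʳ o (Linear-resp-↭ v′ l) ds

-- Inferences on at most four variables

data Tree : Set where
  leaf : Var → Tree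
  node : Op → Tree → Tree → Tree

⌊_⌋ : Tree → Formula
⌊ leaf x ⌋     = var x
⌊ node o s t ⌋ = ⌊ s ⌋ ⟨ o ⟩ ⌊ t ⌋

_==ᵒ_ : Op → Op → Bool
conj ==ᵒ conj = true
disj ==ᵒ disj = true
_    ==ᵒ _    = false

_==ᵗ_ : Tree → Tree → Bool
leaf x     ==ᵗ leaf y       = x ≡ᵇ y
node o s t ==ᵗ node p s′ t′ = (o ==ᵒ p) 𝔹.∧ (s ==ᵗ s′) 𝔹.∧ (t ==ᵗ t′)
_          ==ᵗ _            = false

==ᵒ⇒≡ : ∀ o p → T (o ==ᵒ p) → o ≡ p
==ᵒ⇒≡ conj conj _ = refl
==ᵒ⇒≡ disj disj _ = refl

==ᵗ⇒≡ : ∀ s t → T (s ==ᵗ t) → s ≡ t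
==ᵗ⇒≡ (leaf x)     (leaf y)       h = ≡.cong leaf (ℕ.≡ᵇ⇒≡ x y h)
==ᵗ⇒≡ (node o s t) (node p s′ t′) h with o ==ᵒ p in eqo | s ==ᵗ s′ in eqs | t ==ᵗ t′ in eqt
... | true | true | true
  with refl ← ==ᵒ⇒≡ o p (≡.subst T (≡.sym eqo) tt)
     | refl ← ==ᵗ⇒≡ s s′ (≡.subst T (≡.sym eqs) tt)
     | refl ← ==ᵗ⇒≡ t t′ (≡.subst T (≡.sym eqt) tt) = refl

==ᵗ-refl : ∀ t → T (t ==ᵗ t)
==ᵗ-refl (leaf x) = ℕ.≡⇒≡ᵇ x x refl
==ᵗ-refl (node conj s t) with s ==ᵗ s | ==ᵗ-refl s | t ==ᵗ t | ==ᵗ-refl t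
... | true | _ | true | _ = tt
==ᵗ-refl (node disj s t) with s ==ᵗ s | ==ᵗ-refl s | t ==ᵗ t | ==ᵗ-refl t
... | true | _ | true | _ = tt

_≟ᵗ_ : DecidableEquality Tree
s ≟ᵗ t = map′ (==ᵗ⇒≡ s t) (λ { refl → ==ᵗ-refl s }) (T? (s ==ᵗ t))

head : Tree → Var
head (leaf x)     = x
head (node _ s _) = head s

place : Op → Tree → Tree → Tree
place o s t = if head s ≤?ᵇ head t then node o s t else node o t s

insert : Op → Tree → Tree → Tree
insert o s (leaf x)        = place o s (leaf x)
insert o s (node p t u)    =
  if o ==ᵒ p
  then (if head s ≤?ᵇ head t then node o s (node o t u) else node o t (insert o s u))
  else place o s (node p t u)

merge : Op → Tree → Tree → Tree
merge o (leaf x)     u = insert o (leaf x) u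
merge o (node p s t) u = if o ==ᵒ p then insert o s (merge o t u) else insert o (node p s t) u

-- The arguments of a maximal block of one operator are strung to the right and sorted by their
-- least variable, which in a canonical tree is its `head`. With distinct variables this picks one
-- representative of each AC class, so that `search` can compare trees syntactically.
canon : Tree → Tree
canon (leaf x)     = leaf x
canon (node o s t) = merge o (canon s) (canon t)

-- Exhausts the decompositions of t modulo AC only when t is canonical.
parts : Op → Tree → List (Tree × Tree)
parts o (leaf x)     = []
parts o (node p s t) =
  if o ==ᵒ p
  then (s , t) ∷ (t , s) ∷ concatMap (λ (u , v) → (node o s u , v) ∷ (u , node o s v) ∷ []) (parts o t)
  else []

switches medials : Tree → List Tree
switches t =
  concatMap (λ (x , d) → map (λ (y , z) → node disj (node conj x y) z) (parts disj d)) (parts conj t)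
medials t =
  concatMap (λ (c , d) → concatMap (λ (w , x) → map (λ (y , z) → node conj (node disj w y) (node disj x z))
    (parts conj d)) (parts conj c)) (parts disj t)

-- Rewriting the first component covers both, since `parts` lists every split in both orders. A
-- component may be a block of several arguments of the operator.
inside : (Tree → List Tree) → Op → Tree → List Tree
inside f o t = concatMap (λ (a , b) → map (λ a′ → node o a′ b) (f a)) (parts o t)

reducts : ℕ → Tree → List Tree
reducts zero    t = []
reducts (suc n) t = switches t ++ medials t ++ inside (reducts n) conj t ++ inside (reducts n) disj t

evalᵗ : Assignment → Tree → Bool
evalᵗ ρ (leaf x)     = ρ x
evalᵗ ρ (node o s t) = ⟦ o ⟧ (evalᵗ ρ s) (evalᵗ ρ t)

cons : Bool → Assignment → Assignment
cons b ρ zero    = b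
cons b ρ (suc i) = ρ i

assignments : ℕ → List Assignment
assignments zero    = [ (λ _ → false) ]
assignments (suc m) = concatMap (λ ρ → cons true ρ ∷ cons false ρ ∷ []) (assignments m)

valid? : ℕ → Tree → Tree → Bool
valid? m s t = all (λ ρ → not (evalᵗ ρ s) 𝔹.∨ evalᵗ ρ t) (assignments m)

trivialAt? : ℕ → Tree → Tree → Var → Bool
trivialAt? m s t x = all (λ ρ → not (evalᵗ (ρ [ x ≔ true ]) s) 𝔹.∨ evalᵗ (ρ [ x ≔ false ]) t) (assignments m)

-- The test `valid?` prunes the reducts that no longer imply the target: rewriting is sound, so the
-- target cannot be reached from them.
search : ℕ → ℕ → Tree → Tree → Bool
search m zero    s t = s ==ᵗ t
search m (suc n) s t = (s ==ᵗ t) 𝔹.∨ any (λ s′ → valid? m s′ t 𝔹.∧ search m n s′ t) (map canon (reducts m s))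

splits : List Var → List (List Var × List Var)
splits []       = [ ([] , []) ]
splits (x ∷ xs) = concatMap (λ (ys , zs) → (x ∷ ys , zs) ∷ (ys , x ∷ zs) ∷ []) (splits xs)

mutual
  forms : ℕ → List Var → List Tree
  forms zero    xs = []
  forms (suc n) xs = deduplicate _≟ᵗ_ (atoms xs ++ concatMap (joins n) (splits xs))

  atoms : List Var → List Tree
  atoms (x ∷ []) = [ leaf x ]
  atoms _        = []

  joins : ℕ → List Var × List Var → List Tree
  joins n ([]     , zs)     = []
  joins n (y ∷ ys , [])     = []
  joins n (y ∷ ys , z ∷ zs) =
    concatMap (λ s → concatMap (λ t → canon (node conj s t) ∷ canon (node disj s t) ∷ []) (forms n (z ∷ zs)))
      (forms n (y ∷ ys))

-- Both sides range over formulae on all `m` variables because the two sides of a non-trivial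
-- inference have the same variables. The bounds, `m + m` on the number of steps and `m` on the
-- depth of contexts, are generous guesses that the evaluation in `search-complete` confirms.
search-complete? : ℕ → Bool
search-complete? m = all (λ s → all (λ t →
    not (valid? m s t) 𝔹.∨ any (trivialAt? m s t) (upTo m) 𝔹.∨ search m (m + m) s t) fs) fs
  where fs = forms m (upTo m)

search-complete : ∀ {m} → m ≤ 4 → search-complete? m ≡ true
search-complete {0} _ = refl
search-complete {1} _ = refl
search-complete {2} _ = refl
search-complete {3} _ = refl
search-complete {4} _ = refl
search-complete {suc (suc (suc (suc (suc _))))} (s≤s (s≤s (s≤s (s≤s ()))))

-- Soundness of the search

All-concatMap : ∀ {A B : Set} {P : Pred A 0ℓ} {Q : Pred B 0ℓ} {f : A → List B} {xs} →
  (∀ {x} → P x → All Q (f x)) → All P xs → All Q (concatMap f xs)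
All-concatMap h ps = All.concat⁺ (All.map⁺ (All.map h ps))

place-≈ : ∀ o s t → ⌊ node o s t ⌋ ≈ ⌊ place o s t ⌋
place-≈ o s t with head s ≤?ᵇ head t
... | true  = refl
... | false = ≈-comm o ⌊ s ⌋ ⌊ t ⌋

≈-swap : ∀ o f g h → f ⟨ o ⟩ (g ⟨ o ⟩ h) ≈ g ⟨ o ⟩ (f ⟨ o ⟩ h)
≈-swap o f g h = trans (sym (≈-assoc o f g h)) (trans (cong o (≈-comm o f g) refl) (≈-assoc o g f h))

insert-≈ : ∀ o s t → ⌊ node o s t ⌋ ≈ ⌊ insert o s t ⌋
insert-≈ o s (leaf x) = place-≈ o s (leaf x)
insert-≈ o s (node p t u) with o ==ᵒ p in eq
... | false = place-≈ o s (node p t u)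
... | true with refl ← ==ᵒ⇒≡ o p (from T-≡ eq) | head s ≤?ᵇ head t
... | true  = refl
... | false = trans (≈-swap o ⌊ s ⌋ ⌊ t ⌋ ⌊ u ⌋) (cong o refl (insert-≈ o s u))

merge-≈ : ∀ o s t → ⌊ node o s t ⌋ ≈ ⌊ merge o s t ⌋
merge-≈ o (leaf x) t = insert-≈ o (leaf x) t
merge-≈ o (node p s u) t with o ==ᵒ p in eq
... | false = insert-≈ o (node p s u) t
... | true with refl ← ==ᵒ⇒≡ o p (from T-≡ eq) =
  trans (≈-assoc o ⌊ s ⌋ ⌊ u ⌋ ⌊ t ⌋) (trans (cong o refl (merge-≈ o u t)) (insert-≈ o s (merge o u t)))

canon-≈ : ∀ t → ⌊ t ⌋ ≈ ⌊ canon t ⌋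
canon-≈ (leaf x)     = refl
canon-≈ (node o s t) = trans (cong o (canon-≈ s) (canon-≈ t)) (merge-≈ o (canon s) (canon t))

parts-≈ : ∀ o t → All (λ (u , v) → ⌊ t ⌋ ≈ ⌊ u ⌋ ⟨ o ⟩ ⌊ v ⌋) (parts o t)
parts-≈ o (leaf x) = []
parts-≈ o (node p s t) with o ==ᵒ p in eq
... | false = []
... | true with refl ← ==ᵒ⇒≡ o p (from T-≡ eq) =
  refl ∷ ≈-comm o ⌊ s ⌋ ⌊ t ⌋ ∷ All-concatMap
    (λ {(u , v)} h → trans (cong o refl h) (sym (≈-assoc o ⌊ s ⌋ ⌊ u ⌋ ⌊ v ⌋))
                   ∷ trans (cong o refl h) (≈-swap o ⌊ s ⌋ ⌊ u ⌋ ⌊ v ⌋) ∷ [])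
    (parts-≈ o t)

module Search {S : Pred Inference 0ℓ} (sw : S switch) (md : S medial) where

  infix 4 _⟶_
  _⟶_ : Rel Formula 0ℓ
  f ⟶ g = Linear f → D S f g

  ≈⇒⟶ : ∀ {f g} → f ≈ g → f ⟶ g
  ≈⇒⟶ p l = D-≈ l p

  ⟶-trans : ∀ {f g h} → f ⟶ g → g ⟶ h → f ⟶ h
  ⟶-trans p q l = p l ◅◅ q (Linear-resp-↭ (D-vars (p l)) l)

  switch-⟶ : ∀ x y z → x ∧ (y ∨ z) ⟶ (x ∧ y) ∨ z
  switch-⟶ x y z l = dstep (inj₂ (inst sw σ)) l (↭-sym (↭.++-assoc (vars x) (vars y) (vars z))) ◅ ε
    where
    σ : Subst
    σ 0 = x
    σ 1 = y
    σ _ = z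

  medial-⟶ : ∀ w x y z → (w ∧ x) ∨ (y ∧ z) ⟶ (w ∨ y) ∧ (x ∨ z)
  medial-⟶ w x y z l = dstep (inj₂ (inst md σ)) l same ◅ ε
    where
    σ : Subst
    σ 0 = w
    σ 1 = x
    σ 2 = y
    σ _ = z
    open PermutationReasoning
    same : (vars w ++ vars x) ++ (vars y ++ vars z) ↭ (vars w ++ vars y) ++ (vars x ++ vars z)
    same = begin
      (vars w ++ vars x) ++ (vars y ++ vars z) ↭⟨ ↭.++-assoc (vars w) (vars x) _ ⟩
      vars w ++ (vars x ++ (vars y ++ vars z)) ↭⟨ ↭.++⁺ˡ (vars w) (↭.shifts (vars x) (vars y)) ⟩
      vars w ++ (vars y ++ (vars x ++ vars z)) ↭⟨ ↭.++-assoc (vars w) (vars y) _ ⟨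
      (vars w ++ vars y) ++ (vars x ++ vars z) ∎

  _⇝_ : Tree → Tree → Set
  s ⇝ t = ⌊ s ⌋ ⟶ ⌊ t ⌋

  switches-⇝ : ∀ t → All (t ⇝_) (switches t)
  switches-⇝ t = All-concatMap (λ {(x , d)} p → All.map⁺ (All.map
    (λ {(y , z)} q → ⟶-trans (≈⇒⟶ (trans p (cong conj refl q))) (switch-⟶ ⌊ x ⌋ ⌊ y ⌋ ⌊ z ⌋))
    (parts-≈ disj d))) (parts-≈ conj t)

  medials-⇝ : ∀ t → All (t ⇝_) (medials t)
  medials-⇝ t = All-concatMap (λ {(c , d)} p → All-concatMap (λ {(w , x)} q → All.map⁺ (All.map
    (λ {(y , z)} r → ⟶-trans (≈⇒⟶ (trans p (cong disj q r))) (medial-⟶ ⌊ w ⌋ ⌊ x ⌋ ⌊ y ⌋ ⌊ z ⌋))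
    (parts-≈ conj d))) (parts-≈ conj c)) (parts-≈ disj t)

  inside-⇝ : ∀ {f} → (∀ t → All (t ⇝_) (f t)) → ∀ o t → All (t ⇝_) (inside f o t)
  inside-⇝ h o t = All-concatMap (λ {(a , b)} p → All.map⁺ (All.map
    (λ r → ⟶-trans (≈⇒⟶ p) (λ l → D-ctxˡ o l (r (proj₁ (Linear-⟨⟩⁻ o l)))))
    (h a))) (parts-≈ o t)

  reducts-⇝ : ∀ n t → All (t ⇝_) (reducts n t)
  reducts-⇝ zero    t = []
  reducts-⇝ (suc n) t = All.++⁺ (switches-⇝ t) (All.++⁺ (medials-⇝ t)
    (All.++⁺ (inside-⇝ (reducts-⇝ n) conj t) (inside-⇝ (reducts-⇝ n) disj t)))

  search-⇝ : ∀ m n s t → T (search m n s t) → s ⇝ t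
  search-⇝ m zero    s t h with refl ← ==ᵗ⇒≡ s t h = λ _ → ε
  search-⇝ m (suc n) s t h with to (T-∨ {s ==ᵗ t}) h
  ... | inj₁ e with refl ← ==ᵗ⇒≡ s t e = λ _ → ε
  ... | inj₂ e with s′ , s′∈ , h′ ← find (Any.any⁻ _ (map canon (reducts m s)) e)
               with r , r∈ , refl ← ∈-map⁻ canon s′∈ =
    ⟶-trans (All.lookup (reducts-⇝ m s) r∈)
      (⟶-trans (≈⇒⟶ (canon-≈ r)) (search-⇝ m n s′ t (proj₂ (to T-∧ h′))))

-- Completeness of the enumeration

splits-complete : ∀ as bs xs → as ++ bs ↭ xs →
  ∃[ ys ] ∃[ zs ] ((ys , zs) ∈ splits xs × as ↭ ys × bs ↭ zs)
splits-complete as bs [] p with eq ← ↭.↭-empty-inv p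
  with refl ← ++-conicalˡ as bs eq | refl ← ++-conicalʳ as bs eq = [] , [] , here refl , ↭-refl , ↭-refl
splits-complete as bs (x ∷ xs) p with ∈-++⁻ as (↭.∈-resp-↭ (↭-sym p) (here refl))
... | inj₁ x∈ with cs , ds , refl ← ∈-∃++ x∈ =
  let q = ↭.shift x cs ds
      ys , zs , ∈s , r , r′ = splits-complete (cs ++ ds) bs xs (↭.drop-∷ (↭-trans (↭-sym (↭.++⁺ʳ bs q)) p))
  in x ∷ ys , zs , ∈-concatMap⁺ _ (Any.map (λ { refl → here refl }) ∈s) , ↭-trans q (↭-prep x r) , r′
... | inj₂ x∈ with cs , ds , refl ← ∈-∃++ x∈ =
  let q = ↭.shift x cs ds
      ys , zs , ∈s , r , r′ = splits-complete as (cs ++ ds) xs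
        (↭.drop-∷ (↭-trans (↭-sym (↭-trans (↭.++⁺ˡ as q) (↭.shift x as (cs ++ ds)))) p))
  in ys , x ∷ zs , ∈-concatMap⁺ _ (Any.map (λ { refl → there (here refl) }) ∈s) , r , ↭-trans q (↭-prep x r′)

size : Tree → ℕ
size t = length (vars ⌊ t ⌋)

size-node : ∀ o s t → size (node o s t) ≡ size s + size t
size-node conj s t = length-++ (vars ⌊ s ⌋)
size-node disj s t = length-++ (vars ⌊ s ⌋)

size-pos : ∀ t → 1 ≤ size t
size-pos (leaf x)     = s≤s z≤n
size-pos (node o s t) rewrite size-node o s t = ℕ.≤-trans (size-pos s) (ℕ.m≤m+n _ _)

-- Every tree has a leaf, so both halves of a node are strictly smaller than the node and the fuel
-- `n` lasts. The result is only up to AC because `joins` canonises each node.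
forms-complete : ∀ n t xs → size t ≤ n → vars ⌊ t ⌋ ↭ xs → ∃[ p ] (p ∈ forms n xs × ⌊ t ⌋ ≈ ⌊ p ⌋)
forms-complete zero    t        xs len p = ⊥-elim (ℕ.<⇒≱ (size-pos t) len)
forms-complete (suc n) (leaf x) xs len p with refl ← ↭.↭-singleton-inv (↭-sym p) =
  leaf x , ∈-deduplicate⁺ _≟ᵗ_ {atoms [ x ] ++ concatMap (joins n) (splits [ x ])} (here refl) , refl
forms-complete (suc n) (node o s t) xs len p
  with ys , zs , ∈s , q , r ← splits-complete (vars ⌊ s ⌋) (vars ⌊ t ⌋) xs (↭-trans (↭-reflexive (≡.sym (vars-⟨⟩ o))) p)
  with len ← ≡.subst (_≤ suc n) (size-node o s t) len
  with s′ , s′∈ , s≈ ← forms-complete n s ys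
         (ℕ.≤-pred (ℕ.≤-trans (ℕ.≤-reflexive (ℕ.+-comm 1 _)) (ℕ.≤-trans (ℕ.+-monoʳ-≤ (size s) (size-pos t)) len))) q
     | t′ , t′∈ , t≈ ← forms-complete n t zs
         (ℕ.≤-pred (ℕ.≤-trans (ℕ.+-monoˡ-≤ (size t) (size-pos s)) len)) r =
  canon (node o s′ t′) ,
  ∈-deduplicate⁺ _≟ᵗ_ (∈-++⁺ʳ (atoms xs) (∈-concatMap⁺ (joins n) (Any.map
    (λ { refl → joins-∈ ys zs (pos s q) (pos t r) s′∈ t′∈ }) ∈s))) ,
  trans (cong o s≈ t≈) (canon-≈ (node o s′ t′))
  where
  pos : ∀ t {ys} → vars ⌊ t ⌋ ↭ ys → 1 ≤ length ys
  pos t q = ≡.subst (1 ≤_) (↭.↭-length q) (size-pos t)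
  joins-∈ : ∀ ys zs → 1 ≤ length ys → 1 ≤ length zs → ∀ {s t} → s ∈ forms n ys → t ∈ forms n zs →
    canon (node o s t) ∈ joins n (ys , zs)
  joins-∈ (y ∷ ys) (z ∷ zs) _ _ {s} {t} s∈ t∈ = ∈-concatMap⁺ _ (Any.map (λ { refl →
    ∈-concatMap⁺ _ (Any.map (λ { refl → pick o s t }) t∈) }) s∈)
    where
    pick : ∀ o s t → canon (node o s t) ∈ canon (node conj s t) ∷ canon (node disj s t) ∷ []
    pick conj _ _ = here refl
    pick disj _ _ = there (here refl)

eval-⌊⌋ : ∀ ρ t → evalᵗ ρ t ≡ eval ρ ⌊ t ⌋
eval-⌊⌋ ρ (leaf x)     = refl
eval-⌊⌋ ρ (node o s t) = ≡.trans (≡.cong₂ ⟦ o ⟧ (eval-⌊⌋ ρ s) (eval-⌊⌋ ρ t)) (≡.sym (eval-⟨⟩ o ρ))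

implies⁺ : ∀ {a b} → a ≤ᵇ b → T (not a 𝔹.∨ b)
implies⁺ {true}  h = from T-≡ (h refl)
implies⁺ {false} h = tt

implies⁻ : ∀ a {b} → T (not a 𝔹.∨ b) → a ≤ᵇ b
implies⁻ true h refl = to T-≡ h

assignments-complete : ∀ m (ρ : Assignment) → ∃[ ρ′ ] (ρ′ ∈ assignments m × (∀ {i : Var} → i < m → ρ i ≡ ρ′ i))
assignments-complete zero    ρ = _ , here refl , λ ()
assignments-complete (suc m) ρ with ρ′ , ρ′∈ , h ← assignments-complete m (ρ ∘ suc) =
  cons (ρ 0) ρ′ , ∈-concatMap⁺ _ (Any.map (λ { refl → pick (ρ 0) }) ρ′∈) , agree
  where
  pick : ∀ b → cons b ρ′ ∈ cons true ρ′ ∷ cons false ρ′ ∷ []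
  pick true  = here refl
  pick false = there (here refl)
  agree : ∀ {i} → i < suc m → ρ i ≡ cons (ρ 0) ρ′ i
  agree {zero}  _       = refl
  agree {suc i} (s≤s q) = h q

-- The semantic reading of `TrivialAt`: updating the assignment replaces putting a unit for the
-- variable, so it combines directly with monotonicity and soundness.
Triv : Var → Rel Formula 0ℓ
Triv x f g = ∀ ρ → eval (ρ [ x ≔ true ]) f ≤ᵇ eval (ρ [ x ≔ false ]) g

Valid⇒valid? : ∀ m s t → Valid (⌊ s ⌋ ⇒ ⌊ t ⌋) → T (valid? m s t)
Valid⇒valid? m s t v = All.all⁻ _ (All.universal
  (λ ρ → implies⁺ (λ h → ≡.trans (eval-⌊⌋ ρ t) (v ρ (≡.trans (≡.sym (eval-⌊⌋ ρ s)) h)))) (assignments m))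

trivialAt?⇒Triv : ∀ m s t x → vars ⌊ s ⌋ ⊆ upTo m → vars ⌊ t ⌋ ⊆ upTo m → T (trivialAt? m s t x) → Triv x ⌊ s ⌋ ⌊ t ⌋
trivialAt?⇒Triv m s t x s⊆ t⊆ h ρ e with ρ′ , ρ′∈ , agree ← assignments-complete m ρ =
  ≡.trans (eval-cong {⌊ t ⌋} (upd ∘ t⊆)) (≡.trans (≡.sym (eval-⌊⌋ _ t))
    (implies⁻ _ (All.lookup (All.all⁺ _ (assignments m) h) ρ′∈)
      (≡.trans (eval-⌊⌋ _ s) (≡.trans (≡.sym (eval-cong {⌊ s ⌋} (upd ∘ s⊆))) e))))
  where
  upd : ∀ {y b} → y ∈ upTo m → (ρ [ x ≔ b ]) y ≡ (ρ′ [ x ≔ b ]) y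
  upd {y} {b} y∈ = ≡.cong (if does (y ≟ x) then b else_) (agree (∈-upTo⁻ y∈))

size-upTo : ∀ {m} t → vars ⌊ t ⌋ ↭ upTo m → size t ≤ m
size-upTo {m} t p = ℕ.≤-reflexive (≡.trans (↭.↭-length p) (length-upTo m))

small-complete : ∀ {S : Pred Inference 0ℓ} → S switch → S medial → ∀ {m} → m ≤ 4 → ∀ s t →
  vars ⌊ s ⌋ ↭ upTo m → vars ⌊ t ⌋ ↭ upTo m → Valid (⌊ s ⌋ ⇒ ⌊ t ⌋) →
  (∀ x → x ∈ vars ⌊ s ⌋ → ¬ Triv x ⌊ s ⌋ ⌊ t ⌋) → D S ⌊ s ⌋ ⌊ t ⌋
small-complete {S} sw md {m} m≤4 s t vs vt v nt
  with s′ , s′∈ , s≈ ← forms-complete m s (upTo m) (size-upTo s vs) vs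
     | t′ , t′∈ , t≈ ← forms-complete m t (upTo m) (size-upTo t vt) vt
  = ⟶-trans (≈⇒⟶ s≈) (⟶-trans (search-⇝ m (m + m) s′ t′ found) (≈⇒⟶ (sym t≈)))
      (Unique⇒Linear _ (Unique-resp-↭ (↭-sym vs) (Unique.upTo⁺ m)))
  where
  open Search {S} sw md
  ⊆s′ : vars ⌊ s′ ⌋ ⊆ upTo m
  ⊆s′ = ↭.∈-resp-↭ (↭-trans (↭-sym (≈-vars s≈)) vs)
  ⊆t′ : vars ⌊ t′ ⌋ ⊆ upTo m
  ⊆t′ = ↭.∈-resp-↭ (↭-trans (↭-sym (≈-vars t≈)) vt)
  checked : T (not (valid? m s′ t′) 𝔹.∨ any (trivialAt? m s′ t′) (upTo m) 𝔹.∨ search m (m + m) s′ t′)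
  checked = All.lookup (All.all⁺ _ _ (All.lookup (All.all⁺ _ _ (from T-≡ (search-complete m≤4))) s′∈)) t′∈
  valid′ : Valid (⌊ s′ ⌋ ⇒ ⌊ t′ ⌋)
  valid′ ρ h = ≡.trans (≡.sym (≈-eval t≈ ρ)) (v ρ (≡.trans (≈-eval s≈ ρ) h))
  nontrivial : ¬ T (any (trivialAt? m s′ t′) (upTo m))
  nontrivial h with x , x∈ , tr ← find (Any.any⁻ _ (upTo m) h) =
    nt x (↭.∈-resp-↭ (↭-sym vs) x∈) λ ρ e → ≡.trans (≈-eval t≈ _)
      (trivialAt?⇒Triv m s′ t′ x ⊆s′ ⊆t′ tr ρ (≡.trans (≡.sym (≈-eval s≈ _)) e))
  found : T (search m (m + m) s′ t′)
  found with to (T-∨ {any (trivialAt? m s′ t′) (upTo m)})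
               (from T-≡ (implies⁻ (valid? m s′ t′) checked (to T-≡ (Valid⇒valid? m s′ t′ valid′))))
  ... | inj₁ h = ⊥-elim (nontrivial h)
  ... | inj₂ h = h

-- Non-trivial inferences

eval-absent : ∀ f ρ {x} b c → x ∉ vars f → eval (ρ [ x ≔ b ]) f ≡ eval (ρ [ x ≔ c ]) f
eval-absent f ρ {x} b c x∉ = eval-cong {f} λ {y} y∈ →
  ≡.trans (update-other ρ {x} {y} {b} (λ { refl → x∉ y∈ }))
          (≡.sym (update-other ρ {x} {y} {c} (λ { refl → x∉ y∈ })))

Triv-absentˡ : ∀ {f g x} → Valid (f ⇒ g) → x ∉ vars f → Triv x f g
Triv-absentˡ {f} v x∉ ρ e = v _ (≡.trans (eval-absent f ρ false true x∉) e)

Triv-absentʳ : ∀ {f g x} → Valid (f ⇒ g) → x ∉ vars g → Triv x f g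
Triv-absentʳ {f} {g} v x∉ ρ e = ≡.trans (eval-absent g ρ false true x∉) (v _ e)

-- Negation-free formulae are monotone, so one assignment to the rule's variables is enough if it
-- dominates the instance's values at `y` true on `l` and stays below those at `y` false on `r`. At
-- `x` the values true and false do so whatever `σ x` is; for the other shared variables `apart`
-- makes the value independent of `y`.
Triv-⟪⟫ : ∀ {l r σ x y} → NegationFree l → NegationFree r →
  (∀ {u} → u ≢ x → u ∈ vars l → u ∈ vars r → y ∉ vars (σ u)) → Triv x l r → Triv y (l ⟪ σ ⟫) (r ⟪ σ ⟫)
Triv-⟪⟫ {l} {r} {σ} {x} {y} nl nr apart tr ρ e =
  ≡.trans (eval-⟪⟫ r σ ρ₀) (eval-mono nr down (tr ρ* (eval-mono nl up (≡.trans (≡.sym (eval-⟪⟫ l σ ρ₁)) e))))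
  where
  ρ₁ ρ₀ ρ* : Assignment
  ρ₁ = ρ [ y ≔ true ]
  ρ₀ = ρ [ y ≔ false ]
  -- A variable of `l` is read with `y` true, any other with `y` false; for shared variables other
  -- than `x` both readings agree.
  ρ* u = if does (u ∈? vars l) then eval ρ₁ (σ u) else eval ρ₀ (σ u)
  up : ∀ {u} → u ∈ vars l → eval ρ₁ (σ u) ≤ᵇ (ρ* [ x ≔ true ]) u
  up {u} u∈ h with u ≟ x
  ... | yes refl = update-same ρ* x
  ... | no u≢x rewrite update-other ρ* {x} {u} {true} u≢x | dec-true (u ∈? vars l) u∈ = h
  down : ∀ {u} → u ∈ vars r → (ρ* [ x ≔ false ]) u ≤ᵇ eval ρ₀ (σ u)
  down {u} u∈r h with u ≟ x
  ... | yes refl rewrite update-same ρ* x {false} = case h of λ ()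
  ... | no u≢x rewrite update-other ρ* {x} {u} {false} u≢x with u ∈? vars l
  ... | no  _   = h
  ... | yes u∈l = ≡.trans (eval-absent (σ u) ρ false true (apart u≢x u∈l u∈r)) h

-- The inferences for which units can be eliminated. The class survives everything that elimination
-- does to a step: cutting it at an intermediate formula (`squeeze`), removing a context
-- (`Good-⟨⟩ˡ⁻`, `Good-⟨⟩ʳ⁻`) and passing from an instance to its rule (`Good-⟪⟫⁻`).
record Good (f g : Formula) : Set where
  field
    linearˡ    : Linear f
    linearʳ    : Linear g
    cfˡ        : ConstantFree f
    cfʳ        : ConstantFree g
    nfˡ        : NegationFree f
    nfʳ        : NegationFree g
    valid      : Valid (f ⇒ g)
    nontrivial : ∀ {x} → x ∈ vars f ⊎ x ∈ vars g → ¬ Triv x f g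
open Good

-- A variable absent from one side can be changed freely there, which makes a valid inference
-- trivial at it.
Good-vars : ∀ {f g} → Good f g → vars f ↭ vars g
Good-vars {f} {g} G = ⊆⊇⇒↭ (Linear⇒Unique (linearˡ G)) (Linear⇒Unique (linearʳ G)) ⊆ʳ ⊆ˡ
  where
  ⊆ʳ : vars f ⊆ vars g
  ⊆ʳ {x} x∈ with x ∈? vars g
  ... | yes q = q
  ... | no  q = ⊥-elim (nontrivial G (inj₁ x∈) (Triv-absentʳ {f} {g} (valid G) q))
  ⊆ˡ : vars g ⊆ vars f
  ⊆ˡ {x} x∈ with x ∈? vars f
  ... | yes q = q
  ... | no  q = ⊥-elim (nontrivial G (inj₂ x∈) (Triv-absentˡ {f} {g} (valid G) q))

some-var : ∀ {f} → ConstantFree f → ∃[ x ] x ∈ vars f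
some-var (var x)   = x , here refl
some-var (neg x)   = x , here refl
some-var (and c _) with x , x∈ ← some-var c = x , ∈-++⁺ˡ x∈
some-var (or c _)  with x , x∈ ← some-var c = x , ∈-++⁺ˡ x∈

ConstantFree-⟪⟫⁻ : ∀ {l σ} → NegationFree l → ConstantFree (l ⟪ σ ⟫) → ∀ {x} → x ∈ vars l → ConstantFree (σ x)
ConstantFree-⟪⟫⁻ (var x)       c         (here refl) = c
ConstantFree-⟪⟫⁻ (and {φ} p q) (and c d) x∈ with ∈-++⁻ (vars φ) x∈
... | inj₁ h = ConstantFree-⟪⟫⁻ p c h
... | inj₂ h = ConstantFree-⟪⟫⁻ q d h
ConstantFree-⟪⟫⁻ (or {φ} p q)  (or c d) x∈ with ∈-++⁻ (vars φ) x∈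
... | inj₁ h = ConstantFree-⟪⟫⁻ p c h
... | inj₂ h = ConstantFree-⟪⟫⁻ q d h

NegationFree-⟪⟫⁻ : ∀ {σ} → (∀ x → ConstantFree (dual (σ x)) → ¬ NegationFree (dual (σ x))) →
  ∀ l → ConstantFree (l ⟪ σ ⟫) → NegationFree (l ⟪ σ ⟫) → NegationFree l
NegationFree-⟪⟫⁻ h (var x) _ _ = var x
NegationFree-⟪⟫⁻ h (neg x) c n = ⊥-elim (h x c n)
NegationFree-⟪⟫⁻ h (f ∧ g) (and c d) (and m n) = and (NegationFree-⟪⟫⁻ h f c m) (NegationFree-⟪⟫⁻ h g d n)
NegationFree-⟪⟫⁻ h (f ∨ g) (or c d)  (or m n)  = or (NegationFree-⟪⟫⁻ h f c m) (NegationFree-⟪⟫⁻ h g d n)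

-- Were the rule trivial at `x`, the instance would be trivial at any variable of `σ x`. One exists
-- because `σ x` is constant-free, and linearity of the instance keeps it out of the images of the
-- other variables on the side where `x` occurs.
Good-⟪⟫⁻ : ∀ {σ l r} → Good (l ⟪ σ ⟫) (r ⟪ σ ⟫) → Linear l → Linear r → ConstantFree l → ConstantFree r →
  NegationFree l → NegationFree r → Valid (l ⇒ r) → Good l r
Good-⟪⟫⁻ {σ} {l} {r} G ll lr cl cr nl nr v = record
  { linearˡ = ll ; linearʳ = lr ; cfˡ = cl ; cfʳ = cr ; nfˡ = nl ; nfʳ = nr ; valid = v
  ; nontrivial = nt }
  where
  disjoint : ∀ {f} → Linear (f ⟪ σ ⟫) → ∀ {x u y} → x ∈ vars f → u ∈ vars f → y ∈ vars (σ x) → y ∈ vars (σ u) → x ≡ u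
  disjoint {f} lin = concatMap-disjoint (vars ∘ σ) (≡.subst Unique (vars-⟪⟫ f σ) (Linear⇒Unique lin))
  nt : ∀ {x} → x ∈ vars l ⊎ x ∈ vars r → ¬ Triv x l r
  nt (inj₁ x∈) tr with y , y∈ ← some-var (ConstantFree-⟪⟫⁻ nl (cfˡ G) x∈) =
    nontrivial G (inj₁ (∈-vars-⟪⟫⁺ {l} {σ} x∈ y∈)) (Triv-⟪⟫ {l} {r} {σ} nl nr
      (λ u≢x u∈l _ y∈u → u≢x (≡.sym (disjoint {l} (linearˡ G) x∈ u∈l y∈ y∈u))) tr)
  nt (inj₂ x∈) tr with y , y∈ ← some-var (ConstantFree-⟪⟫⁻ nr (cfʳ G) x∈) =
    nontrivial G (inj₂ (∈-vars-⟪⟫⁺ {r} {σ} x∈ y∈)) (Triv-⟪⟫ {l} {r} {σ} nl nr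
      (λ u≢x _ u∈r y∈u → u≢x (≡.sym (disjoint {r} (linearʳ G) x∈ u∈r y∈ y∈u))) tr)

ConstantFree-⟨⟩⁻ : ∀ o {f g} → ConstantFree (f ⟨ o ⟩ g) → ConstantFree f × ConstantFree g
ConstantFree-⟨⟩⁻ conj (and c d) = c , d
ConstantFree-⟨⟩⁻ disj (or c d)  = c , d

NegationFree-⟨⟩⁻ : ∀ o {f g} → NegationFree (f ⟨ o ⟩ g) → NegationFree f × NegationFree g
NegationFree-⟨⟩⁻ conj (and c d) = c , d
NegationFree-⟨⟩⁻ disj (or c d)  = c , d

-- Unit normal forms

data Norm : Set where
  const : Bool → Norm
  form  : Formula → Norm

combine : Op → Norm → Norm → Norm
combine conj (const true)  n             = n
combine conj (const false) n             = const false
combine disj (const true)  n             = const true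
combine disj (const false) n             = n
combine conj (form f)      (const true)  = form f
combine conj (form f)      (const false) = const false
combine disj (form f)      (const true)  = const true
combine disj (form f)      (const false) = form f
combine o    (form f)      (form g)      = form (f ⟨ o ⟩ g)

dualᴺ : Norm → Norm
dualᴺ (const b) = const (not b)
dualᴺ (form f)  = form (dual f)

-- Normalising by evaluation in an environment makes substituting formulae and setting variables to
-- units the same operation, a choice of `e`; see `norm-⟪⟫`.
norm : (Var → Norm) → Formula → Norm
norm e ⊤       = const true
norm e ⊥       = const false
norm e (var x) = e x
norm e (neg x) = dualᴺ (e x)
norm e (f ∧ g) = combine conj (norm e f) (norm e g)
norm e (f ∨ g) = combine disj (norm e f) (norm e g)

evalᴺ : Assignment → Norm → Bool
evalᴺ ρ (const b) = b
evalᴺ ρ (form f)  = eval ρ f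

varsᴺ : Norm → List Var
varsᴺ (const b) = []
varsᴺ (form f)  = vars f

_⟪_⟫ᴺ : Norm → Subst → Norm
const b ⟪ σ ⟫ᴺ = const b
form f  ⟪ σ ⟫ᴺ = form (f ⟪ σ ⟫)

infix 4 _≈ᴺ_
data _≈ᴺ_ : Rel Norm 0ℓ where
  const : ∀ {b} → const b ≈ᴺ const b
  form  : ∀ {f g} → f ≈ g → form f ≈ᴺ form g

data OnForm (P : Formula → Set) : Norm → Set where
  const : ∀ {b} → OnForm P (const b)
  form  : ∀ {f} → P f → OnForm P (form f)

norm-⟨⟩ : ∀ e o f g → norm e (f ⟨ o ⟩ g) ≡ combine o (norm e f) (norm e g)
norm-⟨⟩ e conj f g = refl
norm-⟨⟩ e disj f g = refl

flip : Op → Op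
flip conj = disj
flip disj = conj

dualᴺ-combine : ∀ o m n → dualᴺ (combine o m n) ≡ combine (flip o) (dualᴺ m) (dualᴺ n)
dualᴺ-combine conj (const true)  n             = refl
dualᴺ-combine conj (const false) n             = refl
dualᴺ-combine disj (const true)  n             = refl
dualᴺ-combine disj (const false) n             = refl
dualᴺ-combine conj (form f)      (const true)  = refl
dualᴺ-combine conj (form f)      (const false) = refl
dualᴺ-combine disj (form f)      (const true)  = refl
dualᴺ-combine disj (form f)      (const false) = refl
dualᴺ-combine conj (form f)      (form g)      = refl
dualᴺ-combine disj (form f)      (form g)      = refl

dualᴺ-involutive : ∀ n → dualᴺ (dualᴺ n) ≡ n
dualᴺ-involutive (const true)  = refl
dualᴺ-involutive (const false) = refl
dualᴺ-involutive (form f)      = ≡.cong form (dual-involutive f)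

norm-dual : ∀ e f → norm e (dual f) ≡ dualᴺ (norm e f)
norm-dual e ⊤       = refl
norm-dual e ⊥       = refl
norm-dual e (var x) = refl
norm-dual e (neg x) = ≡.sym (dualᴺ-involutive (e x))
norm-dual e (f ∧ g) =
  ≡.trans (≡.cong₂ (combine disj) (norm-dual e f) (norm-dual e g)) (≡.sym (dualᴺ-combine conj (norm e f) (norm e g)))
norm-dual e (f ∨ g) =
  ≡.trans (≡.cong₂ (combine conj) (norm-dual e f) (norm-dual e g)) (≡.sym (dualᴺ-combine disj (norm e f) (norm e g)))

norm-⟪⟫ : ∀ e f σ → norm e (f ⟪ σ ⟫) ≡ norm (norm e ∘ σ) f
norm-⟪⟫ e ⊤       σ = refl
norm-⟪⟫ e ⊥       σ = refl
norm-⟪⟫ e (var x) σ = refl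
norm-⟪⟫ e (neg x) σ = norm-dual e (σ x)
norm-⟪⟫ e (f ∧ g) σ = ≡.cong₂ (combine conj) (norm-⟪⟫ e f σ) (norm-⟪⟫ e g σ)
norm-⟪⟫ e (f ∨ g) σ = ≡.cong₂ (combine disj) (norm-⟪⟫ e f σ) (norm-⟪⟫ e g σ)

dualᴺ-⟪⟫ : ∀ n σ → dualᴺ (n ⟪ σ ⟫ᴺ) ≡ dualᴺ n ⟪ σ ⟫ᴺ
dualᴺ-⟪⟫ (const b) σ = refl
dualᴺ-⟪⟫ (form f)  σ = ≡.cong form (dual-⟪⟫ f σ)

combine-⟪⟫ : ∀ o m n σ → combine o (m ⟪ σ ⟫ᴺ) (n ⟪ σ ⟫ᴺ) ≡ combine o m n ⟪ σ ⟫ᴺ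
combine-⟪⟫ conj (const true)  n             σ = refl
combine-⟪⟫ conj (const false) n             σ = refl
combine-⟪⟫ disj (const true)  n             σ = refl
combine-⟪⟫ disj (const false) n             σ = refl
combine-⟪⟫ conj (form f)      (const true)  σ = refl
combine-⟪⟫ conj (form f)      (const false) σ = refl
combine-⟪⟫ disj (form f)      (const true)  σ = refl
combine-⟪⟫ disj (form f)      (const false) σ = refl
combine-⟪⟫ conj (form f)      (form g)      σ = refl
combine-⟪⟫ disj (form f)      (form g)      σ = refl

-- Separates setting variables to units, left to `e′`, from substituting formulae, left to `σ`. The
-- substitution never turns a `form` into a `const`, so all absorption of units happens under `e′`.
norm-factor : ∀ {e e′ σ} → (∀ x → e x ≡ e′ x ⟪ σ ⟫ᴺ) → ∀ f → norm e f ≡ norm e′ f ⟪ σ ⟫ᴺ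
norm-factor h ⊤       = refl
norm-factor h ⊥       = refl
norm-factor h (var x) = h x
norm-factor {e′ = e′} h (neg x) = ≡.trans (≡.cong dualᴺ (h x)) (dualᴺ-⟪⟫ (e′ x) _)
norm-factor {e′ = e′} h (f ∧ g) =
  ≡.trans (≡.cong₂ (combine conj) (norm-factor h f) (norm-factor h g)) (combine-⟪⟫ conj (norm e′ f) (norm e′ g) _)
norm-factor {e′ = e′} h (f ∨ g) =
  ≡.trans (≡.cong₂ (combine disj) (norm-factor h f) (norm-factor h g)) (combine-⟪⟫ disj (norm e′ f) (norm e′ g) _)

-- With no unit in `f` or in the images of its variables nothing is absorbed. This recognises a step
-- whose rule has kept all its variables as a genuine instance of that rule.
norm-form : ∀ {e σ f} → ConstantFree f → (∀ {x} → x ∈ vars f → e x ≡ form (σ x)) → norm e f ≡ form (f ⟪ σ ⟫)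
norm-form (var x) h = h (here refl)
norm-form (neg x) h = ≡.cong dualᴺ (h (here refl))
norm-form {σ = σ} (and {f} c d) h
  rewrite norm-form {σ = σ} c (h ∘ ∈-++⁺ˡ) | norm-form {σ = σ} d (h ∘ ∈-++⁺ʳ (vars f)) = refl
norm-form {σ = σ} (or {f} c d)  h
  rewrite norm-form {σ = σ} c (h ∘ ∈-++⁺ˡ) | norm-form {σ = σ} d (h ∘ ∈-++⁺ʳ (vars f)) = refl

evalᴺ-dual : ∀ ρ n → evalᴺ ρ (dualᴺ n) ≡ not (evalᴺ ρ n)
evalᴺ-dual ρ (const b) = refl
evalᴺ-dual ρ (form f)  = eval-dual f ρ

evalᴺ-combine : ∀ ρ o m n → evalᴺ ρ (combine o m n) ≡ ⟦ o ⟧ (evalᴺ ρ m) (evalᴺ ρ n)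
evalᴺ-combine ρ conj (const true)  n             = refl
evalᴺ-combine ρ conj (const false) n             = refl
evalᴺ-combine ρ disj (const true)  n             = refl
evalᴺ-combine ρ disj (const false) n             = refl
evalᴺ-combine ρ conj (form f)      (const true)  = ≡.sym (𝔹ₚ.∧-identityʳ _)
evalᴺ-combine ρ conj (form f)      (const false) = ≡.sym (𝔹ₚ.∧-zeroʳ _)
evalᴺ-combine ρ disj (form f)      (const true)  = ≡.sym (𝔹ₚ.∨-zeroʳ _)
evalᴺ-combine ρ disj (form f)      (const false) = ≡.sym (𝔹ₚ.∨-identityʳ _)
evalᴺ-combine ρ conj (form f)      (form g)      = refl
evalᴺ-combine ρ disj (form f)      (form g)      = refl

evalᴺ-norm : ∀ ρ e f → evalᴺ ρ (norm e f) ≡ eval (evalᴺ ρ ∘ e) f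
evalᴺ-norm ρ e ⊤       = refl
evalᴺ-norm ρ e ⊥       = refl
evalᴺ-norm ρ e (var x) = refl
evalᴺ-norm ρ e (neg x) = evalᴺ-dual ρ (e x)
evalᴺ-norm ρ e (f ∧ g) =
  ≡.trans (evalᴺ-combine ρ conj (norm e f) (norm e g)) (≡.cong₂ 𝔹._∧_ (evalᴺ-norm ρ e f) (evalᴺ-norm ρ e g))
evalᴺ-norm ρ e (f ∨ g) =
  ≡.trans (evalᴺ-combine ρ disj (norm e f) (norm e g)) (≡.cong₂ 𝔹._∨_ (evalᴺ-norm ρ e f) (evalᴺ-norm ρ e g))

varsᴺ-dual : ∀ n → varsᴺ (dualᴺ n) ≡ varsᴺ n
varsᴺ-dual (const b) = refl
varsᴺ-dual (form f)  = vars-dual f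

varsᴺ-combine : ∀ o m n {x} → x ∈ varsᴺ (combine o m n) → x ∈ varsᴺ m ⊎ x ∈ varsᴺ n
varsᴺ-combine conj (const true)  n             x∈ = inj₂ x∈
varsᴺ-combine disj (const false) n             x∈ = inj₂ x∈
varsᴺ-combine conj (form f)      (const true)  x∈ = inj₁ x∈
varsᴺ-combine disj (form f)      (const false) x∈ = inj₁ x∈
varsᴺ-combine conj (form f)      (form g)      x∈ = ∈-++⁻ (vars f) x∈
varsᴺ-combine disj (form f)      (form g)      x∈ = ∈-++⁻ (vars f) x∈

varsᴺ-norm : ∀ {e} f {x} → x ∈ varsᴺ (norm e f) → ∃[ u ] (u ∈ vars f × x ∈ varsᴺ (e u))
varsᴺ-norm (var u) x∈ = u , here refl , x∈
varsᴺ-norm {e} (neg u) {x} x∈ = u , here refl , ≡.subst (x ∈_) (varsᴺ-dual (e u)) x∈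
varsᴺ-norm {e} (f ∧ g) x∈ with varsᴺ-combine conj (norm e f) (norm e g) x∈
... | inj₁ h with u , u∈ , h′ ← varsᴺ-norm f h = u , ∈-++⁺ˡ u∈ , h′
... | inj₂ h with u , u∈ , h′ ← varsᴺ-norm g h = u , ∈-++⁺ʳ (vars f) u∈ , h′
varsᴺ-norm {e} (f ∨ g) x∈ with varsᴺ-combine disj (norm e f) (norm e g) x∈
... | inj₁ h with u , u∈ , h′ ← varsᴺ-norm f h = u , ∈-++⁺ˡ u∈ , h′
... | inj₂ h with u , u∈ , h′ ← varsᴺ-norm g h = u , ∈-++⁺ʳ (vars f) u∈ , h′

ConstantFree-dual : ∀ {f} → ConstantFree f → ConstantFree (dual f)
ConstantFree-dual (var x)   = neg x
ConstantFree-dual (neg x)   = var x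
ConstantFree-dual (and c d) = or (ConstantFree-dual c) (ConstantFree-dual d)
ConstantFree-dual (or c d)  = and (ConstantFree-dual c) (ConstantFree-dual d)

norm-ConstantFree : ∀ {e} → (∀ x → OnForm ConstantFree (e x)) → ∀ f → OnForm ConstantFree (norm e f)
norm-ConstantFree {e} h = go
  where
  dual-cf : ∀ {n} → OnForm ConstantFree n → OnForm ConstantFree (dualᴺ n)
  dual-cf const    = const
  dual-cf (form c) = form (ConstantFree-dual c)
  combine-cf : ∀ o {m n} → OnForm ConstantFree m → OnForm ConstantFree n → OnForm ConstantFree (combine o m n)
  combine-cf conj (const {true})  d               = d
  combine-cf conj (const {false}) d               = const
  combine-cf disj (const {true})  d               = const
  combine-cf disj (const {false}) d               = d
  combine-cf conj (form c)        (const {true})  = form c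
  combine-cf conj (form c)        (const {false}) = const
  combine-cf disj (form c)        (const {true})  = const
  combine-cf disj (form c)        (const {false}) = form c
  combine-cf conj (form c)        (form d)        = form (and c d)
  combine-cf disj (form c)        (form d)        = form (or c d)
  go : ∀ f → OnForm ConstantFree (norm e f)
  go ⊤       = const
  go ⊥       = const
  go (var x) = h x
  go (neg x) = dual-cf (h x)
  go (f ∧ g) = combine-cf conj (go f) (go g)
  go (f ∨ g) = combine-cf disj (go f) (go g)

-- Environments that only set variables to units or flip their sign. They bring in no variable,
-- hence preserve linearity. The environment of `eliminate` and every `literals e` are of this kind.
data LocalAt (x : Var) : Norm → Set where
  pos   : LocalAt x (form (var x))
  neg   : LocalAt x (form (neg x))
  const : ∀ {b} → LocalAt x (const b)

Local : (Var → Norm) → Set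
Local e = ∀ x → LocalAt x (e x)

Local-vars : ∀ {e} → Local e → ∀ f → varsᴺ (norm e f) ⊆ vars f
Local-vars {e} loc f x∈ with u , u∈ , h ← varsᴺ-norm f x∈ with e u | loc u | h
... | _ | pos | here refl = u∈
... | _ | neg | here refl = u∈

Local-ConstantFree : ∀ {e} → Local e → ∀ x → OnForm ConstantFree (e x)
Local-ConstantFree {e} loc x with e x | loc x
... | _ | pos   = form (var x)
... | _ | neg   = form (neg x)
... | _ | const = const

Local-Linear : ∀ {e} → Local e → ∀ {f} → Linear f → OnForm Linear (norm e f)
Local-Linear {e} loc = go
  where
  combine-linear : ∀ o {m n} → OnForm Linear m → OnForm Linear n → Disjoint (varsᴺ m) (varsᴺ n) →
    OnForm Linear (combine o m n)
  combine-linear conj (const {true})  d               _ = d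
  combine-linear conj (const {false}) d               _ = const
  combine-linear disj (const {true})  d               _ = const
  combine-linear disj (const {false}) d               _ = d
  combine-linear conj (form c)        (const {true})  _ = form c
  combine-linear conj (form c)        (const {false}) _ = const
  combine-linear disj (form c)        (const {true})  _ = const
  combine-linear disj (form c)        (const {false}) _ = form c
  combine-linear conj (form c)        (form d)        x = form (and c d x)
  combine-linear disj (form c)        (form d)        x = form (or c d x)
  leaf-linear : ∀ x → OnForm Linear (e x)
  leaf-linear x with e x | loc x
  ... | _ | pos   = form (var x)
  ... | _ | neg   = form (neg x)
  ... | _ | const = const
  dual-linear : ∀ {n} → OnForm Linear n → OnForm Linear (dualᴺ n)
  dual-linear const        = const
  dual-linear (form {f} l) = form (Linear-resp-↭ (↭-reflexive (≡.sym (vars-dual f))) l)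
  go : ∀ {f} → Linear f → OnForm Linear (norm e f)
  go ⊤                   = const
  go ⊥                   = const
  go (var x)             = leaf-linear x
  go (neg x)             = dual-linear (leaf-linear x)
  go (and {f} {g} p q d) = combine-linear conj (go p) (go q) λ (a , b) → d (Local-vars loc f a , Local-vars loc g b)
  go (or {f} {g} p q d)  = combine-linear disj (go p) (go q) λ (a , b) → d (Local-vars loc f a , Local-vars loc g b)

-- Normal forms modulo associativity and commutativity

≈ᴺ-refl : ∀ {n} → n ≈ᴺ n
≈ᴺ-refl {const b} = const
≈ᴺ-refl {form f}  = form refl

≡⇒≈ᴺ : ∀ {m n} → m ≡ n → m ≈ᴺ n
≡⇒≈ᴺ refl = ≈ᴺ-refl

≈ᴺ-sym : ∀ {m n} → m ≈ᴺ n → n ≈ᴺ m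
≈ᴺ-sym const    = const
≈ᴺ-sym (form p) = form (sym p)

≈ᴺ-trans : ∀ {m n p} → m ≈ᴺ n → n ≈ᴺ p → m ≈ᴺ p
≈ᴺ-trans const    const    = const
≈ᴺ-trans (form p) (form q) = form (trans p q)

≈ᴺ-eval : ∀ {m n} → m ≈ᴺ n → ∀ ρ → evalᴺ ρ m ≡ evalᴺ ρ n
≈ᴺ-eval const    ρ = refl
≈ᴺ-eval (form p) ρ = ≈-eval p ρ

combine-cong : ∀ o {m m′ n n′} → m ≈ᴺ m′ → n ≈ᴺ n′ → combine o m n ≈ᴺ combine o m′ n′
combine-cong conj (const {true})  q               = q
combine-cong conj (const {false}) q               = const
combine-cong disj (const {true})  q               = const
combine-cong disj (const {false}) q               = q
combine-cong conj (form p)        (const {true})  = form p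
combine-cong conj (form p)        (const {false}) = const
combine-cong disj (form p)        (const {true})  = const
combine-cong disj (form p)        (const {false}) = form p
combine-cong conj (form p)        (form q)        = form (cong conj p q)
combine-cong disj (form p)        (form q)        = form (cong disj p q)

unit : Op → Bool
unit conj = true
unit disj = false

combine-unitʳ : ∀ o n → combine o n (const (unit o)) ≡ n
combine-unitʳ conj (const true)  = refl
combine-unitʳ conj (const false) = refl
combine-unitʳ conj (form f)      = refl
combine-unitʳ disj (const true)  = refl
combine-unitʳ disj (const false) = refl
combine-unitʳ disj (form f)      = refl

combine-zeroʳ : ∀ o n → combine o n (const (not (unit o))) ≡ const (not (unit o))
combine-zeroʳ conj (const true)  = refl
combine-zeroʳ conj (const false) = refl
combine-zeroʳ conj (form f)      = refl
combine-zeroʳ disj (const true)  = refl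
combine-zeroʳ disj (const false) = refl
combine-zeroʳ disj (form f)      = refl

combine-comm : ∀ o m n → combine o m n ≈ᴺ combine o n m
combine-comm conj (const true)  n             = ≡⇒≈ᴺ (≡.sym (combine-unitʳ conj n))
combine-comm conj (const false) n             = ≡⇒≈ᴺ (≡.sym (combine-zeroʳ conj n))
combine-comm disj (const true)  n             = ≡⇒≈ᴺ (≡.sym (combine-zeroʳ disj n))
combine-comm disj (const false) n             = ≡⇒≈ᴺ (≡.sym (combine-unitʳ disj n))
combine-comm conj (form f)      (const true)  = ≈ᴺ-refl
combine-comm conj (form f)      (const false) = const
combine-comm disj (form f)      (const true)  = const
combine-comm disj (form f)      (const false) = ≈ᴺ-refl
combine-comm conj (form f)      (form g)      = form (≈-comm conj f g)
combine-comm disj (form f)      (form g)      = form (≈-comm disj f g)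

combine-assoc : ∀ o m n p → combine o (combine o m n) p ≈ᴺ combine o m (combine o n p)
combine-assoc conj (const true)  n             p             = ≈ᴺ-refl
combine-assoc conj (const false) n             p             = const
combine-assoc disj (const true)  n             p             = const
combine-assoc disj (const false) n             p             = ≈ᴺ-refl
combine-assoc conj (form f)      (const true)  p             = ≈ᴺ-refl
combine-assoc conj (form f)      (const false) p             = const
combine-assoc disj (form f)      (const true)  p             = const
combine-assoc disj (form f)      (const false) p             = ≈ᴺ-refl
combine-assoc conj (form f)      (form g)      (const true)  = ≈ᴺ-refl
combine-assoc conj (form f)      (form g)      (const false) = const
combine-assoc disj (form f)      (form g)      (const true)  = const
combine-assoc disj (form f)      (form g)      (const false) = ≈ᴺ-refl
combine-assoc conj (form f)      (form g)      (form h)      = form (≈-assoc conj f g h)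
combine-assoc disj (form f)      (form g)      (form h)      = form (≈-assoc disj f g h)

norm-Cong : ∀ {e} {R : Rel Formula 0ℓ} → (∀ {f g} → R f g → norm e f ≈ᴺ norm e g) →
  ∀ {f g} → Cong R f g → norm e f ≈ᴺ norm e g
norm-Cong h (base _ _ r) = h r
norm-Cong h (refl _)     = ≈ᴺ-refl
norm-Cong h (sym c)      = ≈ᴺ-sym (norm-Cong h c)
norm-Cong h (trans c d)  = ≈ᴺ-trans (norm-Cong h c) (norm-Cong h d)
norm-Cong h (∧ˡ c _ _)   = combine-cong conj (norm-Cong h c) ≈ᴺ-refl
norm-Cong h (∧ʳ c _ _)   = combine-cong conj ≈ᴺ-refl (norm-Cong h c)
norm-Cong h (∨ˡ c _ _)   = combine-cong disj (norm-Cong h c) ≈ᴺ-refl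
norm-Cong h (∨ʳ c _ _)   = combine-cong disj ≈ᴺ-refl (norm-Cong h c)

norm-AC : ∀ {e f g} → AC f g → norm e f ≈ᴺ norm e g
norm-AC {e} (∧-comm f g)    = combine-comm conj (norm e f) (norm e g)
norm-AC {e} (∨-comm f g)    = combine-comm disj (norm e f) (norm e g)
norm-AC {e} (∧-assoc f g h) = combine-assoc conj (norm e f) (norm e g) (norm e h)
norm-AC {e} (∨-assoc f g h) = combine-assoc disj (norm e f) (norm e g) (norm e h)

norm-U : ∀ {e f g} → U f g → norm e f ≈ᴺ norm e g
norm-U {e} (∧⊤ f) = ≡⇒≈ᴺ (combine-unitʳ conj (norm e f))
norm-U     (⊤∧ f) = ≈ᴺ-refl
norm-U {e} (∨⊥ f) = ≡⇒≈ᴺ (combine-unitʳ disj (norm e f))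
norm-U     (⊥∨ f) = ≈ᴺ-refl
norm-U {e} (∧⊥ f) = ≡⇒≈ᴺ (combine-zeroʳ conj (norm e f))
norm-U     (⊥∧ f) = ≈ᴺ-refl
norm-U {e} (∨⊤ f) = ≡⇒≈ᴺ (combine-zeroʳ disj (norm e f))
norm-U     (⊤∨ f) = ≈ᴺ-refl

-- Uniqueness of unit normal forms: `combine` absorbs units as `U` prescribes and is itself
-- associative and commutative up to AC. A step of `_∼acu_` thus shrinks to AC on normal forms.
norm-∼acu : ∀ {e f g} → f ∼acu g → norm e f ≈ᴺ norm e g
norm-∼acu = norm-Cong λ { (inj₁ c) → norm-Cong norm-AC c ; (inj₂ c) → norm-Cong norm-U c }

Cong-Linear : ∀ {R : Rel Formula 0ℓ} {f g} → Cong R f g → Linear f × Linear g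
Cong-Linear (base l m _)  = l , m
Cong-Linear (refl l)      = l , l
Cong-Linear (sym c)       = proj₂ (Cong-Linear c) , proj₁ (Cong-Linear c)
Cong-Linear (trans c d)   = proj₁ (Cong-Linear c) , proj₂ (Cong-Linear d)
Cong-Linear (∧ˡ _ l m)    = l , m
Cong-Linear (∧ʳ _ l m)    = l , m
Cong-Linear (∨ˡ _ l m)    = l , m
Cong-Linear (∨ʳ _ l m)    = l , m

combine-form⁻ : ∀ o m n {f} → combine o m n ≡ form f →
  (m ≡ form f × n ≡ const (unit o)) ⊎ (m ≡ const (unit o) × n ≡ form f) ⊎
  ∃[ g ] ∃[ h ] (m ≡ form g × n ≡ form h × f ≡ g ⟨ o ⟩ h)
combine-form⁻ conj (const true)  n             eq   = inj₂ (inj₁ (refl , eq))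
combine-form⁻ disj (const false) n             eq   = inj₂ (inj₁ (refl , eq))
combine-form⁻ conj (form f)      (const true)  refl = inj₁ (refl , refl)
combine-form⁻ disj (form f)      (const false) refl = inj₁ (refl , refl)
combine-form⁻ conj (form f)      (form g)      refl = inj₂ (inj₂ (f , g , refl , refl , refl))
combine-form⁻ disj (form f)      (form g)      refl = inj₂ (inj₂ (f , g , refl , refl , refl))

-- Elimination of units

Antitone : Var → Formula → Set
Antitone x f = Triv x f f

≡⇒≤ᵇ : ∀ {a b} → a ≡ b → a ≤ᵇ b
≡⇒≤ᵇ refl = id

Triv-⟨⟩ : ∀ o {f f′ g g′ x} → Triv x f g → Triv x f′ g′ → Triv x (f ⟨ o ⟩ f′) (g ⟨ o ⟩ g′)
Triv-⟨⟩ conj a b ρ = ⟦⟧-mono conj (a ρ) (b ρ)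
Triv-⟨⟩ disj {f} a b ρ = ⟦⟧-mono disj {eval (ρ [ _ ≔ true ]) f} (a ρ) (b ρ)

antitone-absent : ∀ {f x} → x ∉ vars f → Antitone x f
antitone-absent {f} x∉ ρ = ≡⇒≤ᵇ (eval-absent f ρ true false x∉)

-- In a linear formula a negated variable occurs nowhere else, so the whole formula is antitone in
-- it.
negationFree⊎antitone : ∀ {f} → Linear f → NegationFree f ⊎ ∃[ x ] (x ∈ vars f × Antitone x f)
negationFree⊎antitone ⊤       = inj₁ ⊤
negationFree⊎antitone ⊥       = inj₁ ⊥
negationFree⊎antitone (var x) = inj₁ (var x)
negationFree⊎antitone (neg x) = inj₂ (x , here refl , anti)
  where
  anti : Antitone x (neg x)
  anti ρ h rewrite update-same ρ x {true} = case h of λ ()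
negationFree⊎antitone (and {f} {g} l m d) with negationFree⊎antitone l | negationFree⊎antitone m
... | inj₁ p            | inj₁ q            = inj₁ (and p q)
... | inj₂ (x , x∈ , a) | _                 = inj₂ (x , ∈-++⁺ˡ x∈ , Triv-⟨⟩ conj {f} {g} {f} {g} a (antitone-absent {g} (λ y∈ → d (x∈ , y∈))))
... | inj₁ _            | inj₂ (x , x∈ , a) = inj₂ (x , ∈-++⁺ʳ (vars f) x∈ , Triv-⟨⟩ conj {f} {g} {f} {g} (antitone-absent {f} (λ y∈ → d (y∈ , x∈))) a)
negationFree⊎antitone (or {f} {g} l m d) with negationFree⊎antitone l | negationFree⊎antitone m
... | inj₁ p            | inj₁ q            = inj₁ (or p q)
... | inj₂ (x , x∈ , a) | _                 = inj₂ (x , ∈-++⁺ˡ x∈ , Triv-⟨⟩ disj {f} {g} {f} {g} a (antitone-absent {g} (λ y∈ → d (x∈ , y∈))))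
... | inj₁ _            | inj₂ (x , x∈ , a) = inj₂ (x , ∈-++⁺ʳ (vars f) x∈ , Triv-⟨⟩ disj {f} {g} {f} {g} (antitone-absent {f} (λ y∈ → d (y∈ , x∈))) a)

-- A unit normal form squeezed between the two sides of a non-trivial inference
-- is neither constant nor contains negations, since either would make the
-- inference trivial somewhere.
squeeze : ∀ {f ψ h} → Good f ψ → OnForm Linear h → OnForm ConstantFree h → varsᴺ h ⊆ vars f →
  (∀ ρ → eval ρ f ≤ᵇ evalᴺ ρ h) → (∀ ρ → evalᴺ ρ h ≤ᵇ eval ρ ψ) →
  ∃[ g ] (h ≡ form g × Good f g × Good g ψ)
squeeze {h = const b} G _ _ _ lo hi with x , x∈ ← some-var (cfˡ G) =
  ⊥-elim (nontrivial G (inj₁ x∈) λ ρ e → hi _ (lo _ e))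
squeeze {f} {ψ} {form g} G (form lg) (form cg) g⊆ lo hi with negationFree⊎antitone lg
... | inj₂ (x , x∈ , anti) = ⊥-elim (nontrivial G (inj₁ (g⊆ x∈)) λ ρ e → hi _ (anti ρ (lo _ e)))
... | inj₁ ng = g , refl
  , record { linearˡ = linearˡ G ; linearʳ = lg ; cfˡ = cfˡ G ; cfʳ = cg ; nfˡ = nfˡ G ; nfʳ = ng ; valid = lo
           ; nontrivial = λ x∈ tr → nontrivial G (inj₁ ([ id , g⊆ ]′ x∈)) λ ρ e → hi _ (tr ρ e) }
  , record { linearˡ = lg ; linearʳ = linearʳ G ; cfˡ = cg ; cfʳ = cfʳ G ; nfˡ = ng ; nfʳ = nfʳ G ; valid = hi
           ; nontrivial = λ x∈ tr → nontrivial G (Sum.map g⊆ id x∈) λ ρ e → tr ρ (lo _ e) }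

Good-⟨⟩ˡ⁻ : ∀ o {f g h} → Valid (f ⇒ g) → Good (f ⟨ o ⟩ h) (g ⟨ o ⟩ h) → Good f g
Good-⟨⟩ˡ⁻ o {f} {g} {h} v G
  with lf , _ , df ← Linear-⟨⟩⁻ o (linearˡ G) | lg , _ , dg ← Linear-⟨⟩⁻ o (linearʳ G) = record
  { linearˡ = lf ; linearʳ = lg
  ; cfˡ = proj₁ (ConstantFree-⟨⟩⁻ o (cfˡ G)) ; cfʳ = proj₁ (ConstantFree-⟨⟩⁻ o (cfʳ G))
  ; nfˡ = proj₁ (NegationFree-⟨⟩⁻ o (nfˡ G)) ; nfʳ = proj₁ (NegationFree-⟨⟩⁻ o (nfʳ G))
  ; valid = v
  ; nontrivial = λ x∈ tr → nontrivial G (Sum.map (∈ˡ f) (∈ˡ g) x∈)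
      (Triv-⟨⟩ o {f} {h} {g} {h} tr (antitone-absent {h} λ y∈ → [ (λ q → df (q , y∈)) , (λ q → dg (q , y∈)) ]′ x∈)) }
  where
  ∈ˡ : ∀ f {x} → x ∈ vars f → x ∈ vars (f ⟨ o ⟩ h)
  ∈ˡ f rewrite vars-⟨⟩ o {f} {h} = ∈-++⁺ˡ

Good-⟨⟩ʳ⁻ : ∀ o {f g h} → Valid (f ⇒ g) → Good (h ⟨ o ⟩ f) (h ⟨ o ⟩ g) → Good f g
Good-⟨⟩ʳ⁻ o {f} {g} {h} v G
  with _ , lf , df ← Linear-⟨⟩⁻ o (linearˡ G) | _ , lg , dg ← Linear-⟨⟩⁻ o (linearʳ G) = record
  { linearˡ = lf ; linearʳ = lg
  ; cfˡ = proj₂ (ConstantFree-⟨⟩⁻ o (cfˡ G)) ; cfʳ = proj₂ (ConstantFree-⟨⟩⁻ o (cfʳ G))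
  ; nfˡ = proj₂ (NegationFree-⟨⟩⁻ o (nfˡ G)) ; nfʳ = proj₂ (NegationFree-⟨⟩⁻ o (nfʳ G))
  ; valid = v
  ; nontrivial = λ x∈ tr → nontrivial G (Sum.map (∈ʳ f) (∈ʳ g) x∈)
      (Triv-⟨⟩ o {h} {f} {h} {g} (antitone-absent {h} λ y∈ → [ (λ q → df (y∈ , q)) , (λ q → dg (y∈ , q)) ]′ x∈) tr) }
  where
  ∈ʳ : ∀ f {x} → x ∈ vars f → x ∈ vars (h ⟨ o ⟩ f)
  ∈ʳ f rewrite vars-⟨⟩ o {h} {f} = ∈-++⁺ʳ (vars h)

vars-absorb : ∀ {f} → ConstantFree f → ∀ {xs} → ¬ (xs ↭ xs ++ vars f)
vars-absorb {f} c {xs} p with x , x∈ ← some-var c = ℕ.<⇒≢ (begin-strict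
  length xs                   <⟨ ℕ.m<m+n (length xs) (∈-length x∈) ⟩
  length xs + length (vars f) ≡⟨ length-++ xs ⟨
  length (xs ++ vars f)       ∎) (↭.↭-length p)
  where open ℕ.≤-Reasoning

-- Excludes a step whose redex becomes a unit on one side only: the surviving context would then
-- have as many variables as context and constant-free redex together.
absorbʳ : ∀ o {g h} → ConstantFree (h ⟨ o ⟩ g) → ¬ (vars h ↭ vars (h ⟨ o ⟩ g))
absorbʳ o c p = vars-absorb (proj₂ (ConstantFree-⟨⟩⁻ o c)) (↭-trans p (↭-reflexive (vars-⟨⟩ o)))

absorbˡ : ∀ o {g h} → ConstantFree (g ⟨ o ⟩ h) → ¬ (vars h ↭ vars (g ⟨ o ⟩ h))
absorbˡ o {g} {h} c p = vars-absorb (proj₁ (ConstantFree-⟨⟩⁻ o c))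
  (↭-trans p (↭-trans (↭-reflexive (vars-⟨⟩ o)) (↭.++-comm (vars g) (vars h))))

NegationFree-clash : ∀ {f} → ConstantFree f → NegationFree f → ¬ NegationFree (dual f)
NegationFree-clash (var x)   _ ()
NegationFree-clash (and c _) (and m _) (or n _)  = NegationFree-clash c m n
NegationFree-clash (or c _)  (or m _)  (and n _) = NegationFree-clash c m n

-- Instances of rules

negationFree? : ∀ f → Dec (NegationFree f)
negationFree? ⊤       = yes ⊤
negationFree? ⊥       = yes ⊥
negationFree? (var x) = yes (var x)
negationFree? (neg x) = no λ ()
negationFree? (f ∧ g) = map′ (λ (m , n) → and m n) (NegationFree-⟨⟩⁻ conj) (negationFree? f ×-dec negationFree? g)
negationFree? (f ∨ g) = map′ (λ (m , n) → or m n) (NegationFree-⟨⟩⁻ disj) (negationFree? f ×-dec negationFree? g)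

-- A substituted formula n is split as body n under a literal on x, the literal
-- chosen so that body n is negation-free whenever n can occur in a
-- negation-free formula.
literal : Var → Norm → Norm
literal x (const b) = const b
literal x (form h)  = form (if does (negationFree? h) then var x else neg x)

literals : (Var → Norm) → Var → Norm
literals e x = literal x (e x)

body : Norm → Formula
-- The default has to be a unit: a constant-free instance then shows that a variable set to a
-- constant no longer occurs in the instantiated rule.
body (const b) = ⊤
body (form h)  = if does (negationFree? h) then h else dual h

literal-body : ∀ {x σ} n → σ x ≡ body n → n ≡ literal x n ⟪ σ ⟫ᴺ
literal-body (const b) _  = refl
literal-body (form h)  eq with does (negationFree? h)
... | true  = ≡.cong form (≡.sym eq)
... | false = ≡.cong form (≡.sym (≡.trans (≡.cong dual eq) (dual-involutive h)))

literal-local : ∀ x n → LocalAt x (literal x n)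
literal-local x (const b) = const
literal-local x (form h) with does (negationFree? h)
... | true  = pos
... | false = neg

-- If `h` is negation-free, its dual is not, by `NegationFree-clash`; otherwise `body` is `dual h`,
-- whose dual is `h` again. Hence no negated variable is left in a rule with a constant-free,
-- negation-free instance under `body`.
dual-body : ∀ {n} → OnForm ConstantFree n → ConstantFree (dual (body n)) → ¬ NegationFree (dual (body n))
dual-body const ()
dual-body (form {h} c) _ with negationFree? h
... | yes m = NegationFree-clash c m
... | no ¬m = λ m → ¬m (≡.subst NegationFree (dual-involutive h) m)

Valid-norm : ∀ e l r {f g} → Valid (l ⇒ r) → norm e l ≡ form f → norm e r ≡ form g → Valid (f ⇒ g)
Valid-norm e l r v eqˡ eqʳ ρ h =
  ≡.trans (≡.cong (evalᴺ ρ) (≡.sym eqʳ)) (≡.trans (evalᴺ-norm ρ e r)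
    (v _ (≡.trans (≡.sym (evalᴺ-norm ρ e l)) (≡.trans (≡.cong (evalᴺ ρ) eqˡ) h))))

form-⟪⟫⁻ : ∀ n {σ f} → n ⟪ σ ⟫ᴺ ≡ form f → ∃[ l ] (n ≡ form l × f ≡ l ⟪ σ ⟫)
form-⟪⟫⁻ (form l) refl = l , refl , refl

OnForm-form : ∀ {P n f} → OnForm P n → n ≡ form f → P f
OnForm-form (form p) refl = p

unform : Norm → Formula
unform (const _) = ⊤
unform (form f)  = f

all-form⊎some-const : ∀ (e : Var → Norm) xs →
  (∀ {x} → x ∈ xs → e x ≡ form (unform (e x))) ⊎ ∃[ x ] ∃[ b ] (x ∈ xs × e x ≡ const b)
all-form⊎some-const e []       = inj₁ λ ()
all-form⊎some-const e (x ∷ xs) with e x in eq | all-form⊎some-const e xs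
... | const b | _                         = inj₂ (x , b , here refl , eq)
... | form f  | inj₂ (y , b , y∈ , h)     = inj₂ (y , b , there y∈ , h)
... | form f  | inj₁ h                    = inj₁ λ where
  (here refl) → ≡.trans eq (≡.cong (form ∘ unform) (≡.sym eq))
  (there x∈)  → h x∈

ivars⁺ : ∀ {l r x} → x ∈ vars l ⊎ x ∈ vars r → x ∈ ivars (l ⇒ r)
ivars⁺ {l} (inj₁ x∈) = ∈-deduplicate⁺ _≟_ (∈-++⁺ˡ x∈)
ivars⁺ {l} (inj₂ x∈) = ∈-deduplicate⁺ _≟_ (∈-++⁺ʳ (vars l) x∈)

-- `S` holds the rules of the derivation with units, `T` those allowed without. A rule on fewer than
-- `k` variables may lie outside `T`: only its instantiated form, which is `Good`, is used, and
-- `smaller` derives it. A rule of `T` on `k` variables is either applied as it stands or drops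
-- below `k` once a unit is put for one of its variables.
module Elimination {S T : Pred Inference 0ℓ} {k : ℕ}
  (rules   : ∀ {l r} → S (l ⇒ r) → LinearInference (l ⇒ r) ×
    ((T (l ⇒ r) × ConstantFreeInf (l ⇒ r) × length (ivars (l ⇒ r)) ≤ k) ⊎ length (ivars (l ⇒ r)) < k))
  (smaller : ∀ {f g} → Good f g → length (vars f) < k → D T f g)
  where

  RawStep-valid : ∀ {f g} → RawStep S f g → Valid (f ⇒ g)
  RawStep-valid (inst {l} {r} s σ) ρ h =
    ≡.trans (eval-⟪⟫ r σ ρ) (LinearInference.valid (proj₁ (rules s)) _ (≡.trans (≡.sym (eval-⟪⟫ l σ ρ)) h))
  RawStep-valid (ctxˡ conj s) ρ = ⟦⟧-mono conj (RawStep-valid s ρ) id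
  RawStep-valid (ctxˡ disj {f} s) ρ = ⟦⟧-mono disj {eval ρ f} (RawStep-valid s ρ) id
  RawStep-valid (ctxʳ conj s) ρ = ⟦⟧-mono conj id (RawStep-valid s ρ)
  RawStep-valid (ctxʳ disj {h = h} s) ρ = ⟦⟧-mono disj {eval ρ h} id (RawStep-valid s ρ)

  inst-D : ∀ {e l r f g} → (∀ x → OnForm ConstantFree (e x)) → S (l ⇒ r) →
    norm e l ≡ form f → norm e r ≡ form g → Good f g → D T f g
  inst-D {e} {l} {r} {f} {g} cf s eqˡ eqʳ G
    with l′ , eql′ , refl ← form-⟪⟫⁻ (norm (literals e) l) (≡.trans (≡.sym (norm-factor (λ x → literal-body (e x) refl) l)) eqˡ)
       | r′ , eqr′ , refl ← form-⟪⟫⁻ (norm (literals e) r) (≡.trans (≡.sym (norm-factor (λ x → literal-body (e x) refl) r)) eqʳ)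
    = by-rule (proj₂ (rules s))
    where
    σ : Subst
    σ = body ∘ e
    local : Local (literals e)
    local x = literal-local x (e x)
    nfl′ : NegationFree l′
    nfl′ = NegationFree-⟪⟫⁻ (λ x → dual-body (cf x)) l′ (cfˡ G) (nfˡ G)
    G′ : Good l′ r′
    G′ = Good-⟪⟫⁻ {σ} G
      (OnForm-form (Local-Linear local (LinearInference.premise-linear (proj₁ (rules s)))) eql′)
      (OnForm-form (Local-Linear local (LinearInference.conclusion-linear (proj₁ (rules s)))) eqr′)
      (OnForm-form (norm-ConstantFree (Local-ConstantFree local) l) eql′)
      (OnForm-form (norm-ConstantFree (Local-ConstantFree local) r) eqr′)
      nfl′
      (NegationFree-⟪⟫⁻ (λ x → dual-body (cf x)) r′ (cfʳ G) (nfʳ G))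
      (Valid-norm (literals e) l r (LinearInference.valid (proj₁ (rules s))) eql′ eqr′)
    l′⊆ : vars l′ ⊆ ivars (l ⇒ r)
    l′⊆ {x} x∈ = ivars⁺ {l} {r} (inj₁ (Local-vars local l (≡.subst (λ n → x ∈ varsᴺ n) (≡.sym eql′) x∈)))
    u′ : Unique (vars l′)
    u′ = Linear⇒Unique (linearˡ G′)
    via-smaller : length (vars l′) < k → D T (l′ ⟪ σ ⟫) (r′ ⟪ σ ⟫)
    via-smaller len = D-⟪⟫ σ (linearˡ G) (smaller G′ len)
    body-const : ∀ {n b} → n ≡ const b → ¬ ConstantFree (body n)
    body-const refl ()
    by-rule : _ → D T (l′ ⟪ σ ⟫) (r′ ⟪ σ ⟫)
    by-rule (inj₂ len) = via-smaller (ℕ.≤-<-trans (⊆-length u′ l′⊆) len)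
    by-rule (inj₁ (t , (cl , cr) , len)) with all-form⊎some-const e (ivars (l ⇒ r))
    -- The variable `x` belongs to the rule but not to `l′`, which makes the inclusion of variables
    -- strict.
    ... | inj₂ (x , b , x∈ , eq) = via-smaller (ℕ.<-≤-trans
      (⊆-length-< u′ l′⊆ x∈ (λ x∈l′ → body-const eq (ConstantFree-⟪⟫⁻ nfl′ (cfˡ G) x∈l′))) len)
    ... | inj₁ h = dstep (inj₂ (≡.subst₂ (RawStep T)
        (form-injective (≡.trans (≡.sym (norm-form cl (h ∘ ivars⁺ {l} {r} ∘ inj₁))) eqˡ))
        (form-injective (≡.trans (≡.sym (norm-form cr (h ∘ ivars⁺ {l} {r} ∘ inj₂))) eqʳ))
        (inst t (unform ∘ e)))) (linearˡ G) (Good-vars G) ◅ ε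
      where
      form-injective : ∀ {f g} → form f ≡ form g → f ≡ g
      form-injective refl = refl

  -- The argument beside the redex has the same normal form on both sides. If it is a unit, the
  -- context disappears; if it is a formula and both redexes become units, the step disappears. One
  -- redex alone cannot become a unit, since variables would be lost or gained. Otherwise the
  -- context survives and the inference inside it is again `Good`.
  step-D : ∀ {e a b f g} → (∀ x → OnForm ConstantFree (e x)) → RawStep S a b →
    norm e a ≡ form f → norm e b ≡ form g → Good f g → D T f g
  step-D {e} cf (inst {l} {r} s σ) eqˡ eqʳ G =
    inst-D (λ x → norm-ConstantFree cf (σ x)) s
      (≡.trans (≡.sym (norm-⟪⟫ e l σ)) eqˡ) (≡.trans (≡.sym (norm-⟪⟫ e r σ)) eqʳ) G
  step-D {e} cf (ctxˡ o {a} {b} {c} s) eqˡ eqʳ G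
    with combine-form⁻ o (norm e a) (norm e c) (≡.trans (≡.sym (norm-⟨⟩ e o a c)) eqˡ)
       | combine-form⁻ o (norm e b) (norm e c) (≡.trans (≡.sym (norm-⟨⟩ e o b c)) eqʳ)
  ... | inj₁ (ma , mc) | inj₁ (mb , _) = step-D cf s ma mb G
  ... | inj₁ (_ , mc) | inj₂ (inj₁ (_ , mc′)) = case ≡.trans (≡.sym mc) mc′ of λ ()
  ... | inj₁ (_ , mc) | inj₂ (inj₂ (_ , _ , _ , mc′ , _)) = case ≡.trans (≡.sym mc) mc′ of λ ()
  ... | inj₂ (inj₁ (_ , mc)) | inj₁ (_ , mc′) = case ≡.trans (≡.sym mc) mc′ of λ ()
  ... | inj₂ (inj₂ (_ , _ , _ , mc , _)) | inj₁ (_ , mc′) = case ≡.trans (≡.sym mc) mc′ of λ ()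
  ... | inj₂ (inj₁ (_ , mc)) | inj₂ (inj₁ (_ , mc′)) with refl ← ≡.trans (≡.sym mc) mc′ = ε
  ... | inj₂ (inj₁ (_ , mc)) | inj₂ (inj₂ (g , h , _ , mc′ , refl)) with refl ← ≡.trans (≡.sym mc) mc′ =
    ⊥-elim (absorbˡ o {g} {h} (cfʳ G) (Good-vars G))
  ... | inj₂ (inj₂ (f , h , _ , mc , refl)) | inj₂ (inj₁ (_ , mc′)) with refl ← ≡.trans (≡.sym mc) mc′ =
    ⊥-elim (absorbˡ o {f} {h} (cfˡ G) (↭-sym (Good-vars G)))
  ... | inj₂ (inj₂ (f , h , ma , mc , refl)) | inj₂ (inj₂ (g , _ , mb , mc′ , refl)) with refl ← ≡.trans (≡.sym mc) mc′ =
    D-ctxˡ o (linearˡ G) (step-D cf s ma mb (Good-⟨⟩ˡ⁻ o (Valid-norm e a b (RawStep-valid s) ma mb) G))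
  step-D {e} cf (ctxʳ o {a} {b} {c} s) eqˡ eqʳ G
    with combine-form⁻ o (norm e c) (norm e a) (≡.trans (≡.sym (norm-⟨⟩ e o c a)) eqˡ)
       | combine-form⁻ o (norm e c) (norm e b) (≡.trans (≡.sym (norm-⟨⟩ e o c b)) eqʳ)
  ... | inj₂ (inj₁ (mc , ma)) | inj₂ (inj₁ (_ , mb)) = step-D cf s ma mb G
  ... | inj₂ (inj₁ (mc , _)) | inj₁ (mc′ , _) = case ≡.trans (≡.sym mc) mc′ of λ ()
  ... | inj₂ (inj₁ (mc , _)) | inj₂ (inj₂ (_ , _ , mc′ , _)) = case ≡.trans (≡.sym mc) mc′ of λ ()
  ... | inj₁ (mc , _) | inj₂ (inj₁ (mc′ , _)) = case ≡.trans (≡.sym mc) mc′ of λ ()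
  ... | inj₂ (inj₂ (_ , _ , mc , _)) | inj₂ (inj₁ (mc′ , _)) = case ≡.trans (≡.sym mc) mc′ of λ ()
  ... | inj₁ (mc , _) | inj₁ (mc′ , _) with refl ← ≡.trans (≡.sym mc) mc′ = ε
  ... | inj₁ (mc , _) | inj₂ (inj₂ (h , g , mc′ , _ , refl)) with refl ← ≡.trans (≡.sym mc) mc′ =
    ⊥-elim (absorbʳ o {g} {h} (cfʳ G) (Good-vars G))
  ... | inj₂ (inj₂ (h , f , mc , _ , refl)) | inj₁ (mc′ , _) with refl ← ≡.trans (≡.sym mc) mc′ =
    ⊥-elim (absorbʳ o {f} {h} (cfˡ G) (↭-sym (Good-vars G)))
  ... | inj₂ (inj₂ (h , f , mc , ma , refl)) | inj₂ (inj₂ (_ , g , mc′ , mb , refl)) with refl ← ≡.trans (≡.sym mc) mc′ =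
    D-ctxʳ o (linearˡ G) (step-D cf s ma mb (Good-⟨⟩ʳ⁻ o (Valid-norm e a b (RawStep-valid s) ma mb) G))

  eliminate : ∀ {φ ψ} → Good φ ψ → DerivableWithUnits S (φ ⇒ ψ) → D T φ ψ
  eliminate {φ} {ψ} G₀ ds₀ = run ds₀ (norm-var (cfˡ G₀) id) G₀ id
    where
    e : Var → Norm
    -- A foreign variable gets the same value all along the derivation, so soundness of its steps
    -- carries over to the normal forms.
    e x = if does (x ∈? vars φ) then form (var x) else const true

    local : Local e
    local x with does (x ∈? vars φ)
    ... | true  = pos
    ... | false = const

    e-∈ : ∀ {x} → x ∈ vars φ → e x ≡ form (var x)
    e-∈ {x} x∈ rewrite dec-true (x ∈? vars φ) x∈ = refl

    norm-var : ∀ {f} → ConstantFree f → vars f ⊆ vars φ → norm e f ≡ form f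
    norm-var {f} c f⊆ = ≡.trans (norm-form c (λ x∈ → e-∈ (f⊆ x∈))) (≡.cong form (⟪⟫-id {f} λ _ → refl))

    norm-vars : ∀ f → varsᴺ (norm e f) ⊆ vars φ
    norm-vars f {x} x∈ with u , _ , h ← varsᴺ-norm f x∈ with u ∈? vars φ
    ... | yes u∈ with here refl ← h = u∈

    infix 4 _⊑_
    _⊑_ : Rel Formula 0ℓ
    f ⊑ g = ∀ ρ → evalᴺ ρ (norm e f) ≤ᵇ evalᴺ ρ (norm e g)

    ∼acu-⊑ : ∀ {f g} → f ∼acu g → f ⊑ g
    ∼acu-⊑ p ρ = ≡⇒≤ᵇ (≈ᴺ-eval (norm-∼acu p) ρ)

    RawStep-⊑ : ∀ {f g} → RawStep S f g → f ⊑ g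
    RawStep-⊑ {f} {g} s ρ h =
      ≡.trans (evalᴺ-norm ρ e g) (RawStep-valid s _ (≡.trans (≡.sym (evalᴺ-norm ρ e f)) h))

    run-⊑ : ∀ {f g} → Star (RewriteU S ∪₂ _∼acu_) f g → f ⊑ g
    run-⊑ ε ρ = id
    run-⊑ (inj₂ p ◅ ds) ρ = run-⊑ ds ρ ∘ ∼acu-⊑ p ρ
    run-⊑ (inj₁ (_ , _ , p , s , q) ◅ ds) ρ =
      run-⊑ ds ρ ∘ ∼acu-⊑ q ρ ∘ RawStep-⊑ (Step⇒RawStep s) ρ ∘ ∼acu-⊑ p ρ

    ψ-form : norm e ψ ≡ form ψ
    ψ-form = norm-var (cfʳ G₀) (↭.∈-resp-↭ (↭-sym (Good-vars G₀)))

    -- Soundness of the remaining derivation puts `b` below `ψ`, as `squeeze` requires. Normal forms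
    -- contain only variables of `φ`, and `Good-vars` keeps all of these present, which maintains
    -- the inclusion for the next step.
    advance : ∀ a b {f} → norm e a ≡ form f → Good f ψ → vars φ ⊆ vars f → Linear b → a ⊑ b → b ⊑ ψ →
      (∀ {g} → norm e b ≡ form g → Good f g → D T f g) →
      ∃[ g ] (norm e b ≡ form g × Good g ψ × vars φ ⊆ vars g × D T f g)
    advance a b eqa G φ⊆ lb lo hi derive
      with g , eqb , Gfg , Ggψ ← squeeze G (Local-Linear local lb) (norm-ConstantFree (Local-ConstantFree local) b)
             (λ x∈ → φ⊆ (norm-vars b x∈))
             (λ ρ h → lo ρ (≡.trans (≡.cong (evalᴺ ρ) eqa) h))
             (λ ρ h → ≡.trans (≡.cong (evalᴺ ρ) (≡.sym ψ-form)) (hi ρ h))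
      = g , eqb , Ggψ , (λ x∈ → ↭.∈-resp-↭ (Good-vars Gfg) (φ⊆ x∈)) , derive eqb Gfg

    ∼acu-D : ∀ {a b f g} → a ∼acu b → norm e a ≡ form f → norm e b ≡ form g → Good f g → D T f g
    ∼acu-D p eqa eqb G with form q ← ≡.subst₂ _≈ᴺ_ eqa eqb (norm-∼acu p) = D-≈ (linearˡ G) q

    run : ∀ {a f} → Star (RewriteU S ∪₂ _∼acu_) a ψ → norm e a ≡ form f → Good f ψ → vars φ ⊆ vars f → D T f ψ
    run ε eqa G φ⊆ with refl ← ≡.trans (≡.sym eqa) ψ-form = ε
    run {a} (_◅_ {j = b} (inj₂ p) ds) eqa G φ⊆
      with g , eqb , G′ , φ⊆′ , d ← advance a b eqa G φ⊆ (proj₂ (Cong-Linear p)) (∼acu-⊑ p) (run-⊑ ds) (∼acu-D p eqa)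
      = d ◅◅ run ds eqb G′ φ⊆′
    run {a} (_◅_ {j = d} (inj₁ (b , c , p , s , q)) ds) eqa G φ⊆
      with g , eqb , Gb , φ⊆b , d₁ ← advance a b eqa G φ⊆ (proj₂ (Cong-Linear p)) (∼acu-⊑ p)
             (λ ρ → run-⊑ ds ρ ∘ ∼acu-⊑ q ρ ∘ RawStep-⊑ (Step⇒RawStep s) ρ) (∼acu-D p eqa)
      with h , eqc , Gc , φ⊆c , d₂ ← advance b c eqb Gb φ⊆b (proj₁ (Cong-Linear q)) (RawStep-⊑ (Step⇒RawStep s))
             (λ ρ → run-⊑ ds ρ ∘ ∼acu-⊑ q ρ) (step-D (Local-ConstantFree local) (Step⇒RawStep s) eqb)
      with _ , eqd , Gd , φ⊆d , d₃ ← advance c d eqc Gc φ⊆c (proj₂ (Cong-Linear q)) (∼acu-⊑ q) (run-⊑ ds) (∼acu-D q eqc)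
      = d₁ ◅◅ d₂ ◅◅ d₃ ◅◅ run ds eqd Gd φ⊆d

-- Minimal families

vars-rename : ∀ f (ι : Var → Var) → vars (f ⟪ var ∘ ι ⟫) ≡ map ι (vars f)
vars-rename ⊤       ι = refl
vars-rename ⊥       ι = refl
vars-rename (var x) ι = refl
vars-rename (neg x) ι = refl
vars-rename (f ∧ g) ι = ≡.trans (≡.cong₂ _++_ (vars-rename f ι) (vars-rename g ι)) (≡.sym (map-++ ι (vars f) (vars g)))
vars-rename (f ∨ g) ι = ≡.trans (≡.cong₂ _++_ (vars-rename f ι) (vars-rename g ι)) (≡.sym (map-++ ι (vars f) (vars g)))

ConstantFree-rename : ∀ {f} (ι : Var → Var) → ConstantFree f → ConstantFree (f ⟪ var ∘ ι ⟫)
ConstantFree-rename ι (var x)   = var (ι x)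
ConstantFree-rename ι (neg x)   = neg (ι x)
ConstantFree-rename ι (and c d) = and (ConstantFree-rename ι c) (ConstantFree-rename ι d)
ConstantFree-rename ι (or c d)  = or (ConstantFree-rename ι c) (ConstantFree-rename ι d)

NegationFree-rename : ∀ {f} (ι : Var → Var) → NegationFree f → NegationFree (f ⟪ var ∘ ι ⟫)
NegationFree-rename ι ⊤         = ⊤
NegationFree-rename ι ⊥         = ⊥
NegationFree-rename ι (var x)   = var (ι x)
NegationFree-rename ι (and m n) = and (NegationFree-rename ι m) (NegationFree-rename ι n)
NegationFree-rename ι (or m n)  = or (NegationFree-rename ι m) (NegationFree-rename ι n)

position : List Var → Var → ℕ
position []       x = 0
position (v ∷ vs) x = if does (x ≟ v) then 0 else suc (position vs x)

entry : List Var → ℕ → Var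
entry []       i       = 0
entry (v ∷ vs) zero    = v
entry (v ∷ vs) (suc i) = entry vs i

entry-position : ∀ {vs x} → x ∈ vs → entry vs (position vs x) ≡ x
entry-position {v ∷ vs} {x} x∈ with x ≟ v
entry-position {v ∷ vs} x∈         | yes refl rewrite dec-true (v ≟ v) refl = refl
entry-position {v ∷ vs} {x} x∈     | no x≢v   rewrite dec-false (x ≟ v) x≢v with x∈
... | here x≡v = ⊥-elim (x≢v x≡v)
... | there q  = entry-position q

position-< : ∀ {vs x} → x ∈ vs → position vs x < length vs
position-< {v ∷ vs} {x} x∈ with x ≟ v
position-< {v ∷ vs} x∈         | yes refl rewrite dec-true (v ≟ v) refl = s≤s z≤n
position-< {v ∷ vs} {x} x∈     | no x≢v   rewrite dec-false (x ≟ v) x≢v with x∈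
... | here x≡v = ⊥-elim (x≢v x≡v)
... | there q  = s≤s (position-< q)

to-tree : ∀ {f} → ConstantFree f → NegationFree f → ∃[ t ] ⌊ t ⌋ ≡ f
to-tree (var x)   _ = leaf x , refl
to-tree (and c d) (and m n) with s , refl ← to-tree c m | t , refl ← to-tree d n = node conj s t , refl
to-tree (or c d)  (or m n)  with s , refl ← to-tree c m | t , refl ← to-tree d n = node disj s t , refl

module Renaming (vs : List Var) where

  to-position to-entry : Subst
  to-position = var ∘ position vs
  to-entry    = var ∘ entry vs

  back : ∀ {f} → vars f ⊆ vs → (f ⟪ to-position ⟫) ⟪ to-entry ⟫ ≡ f
  back {f} f⊆ = ≡.trans (⟪⟫-⟪⟫ f to-position to-entry) (⟪⟫-id {f} λ x∈ → ≡.cong var (entry-position (f⊆ x∈)))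

  linear : ∀ {f} → vars f ⊆ vs → Linear f → Linear (f ⟪ to-position ⟫)
  linear {f} f⊆ l = Unique⇒Linear _ (Unique.map⁻ (≡.subst Unique
    (≡.trans (≡.sym (≡.cong vars (back {f} f⊆))) (vars-rename (f ⟪ to-position ⟫) (entry vs))) (Linear⇒Unique l)))

  -- The renaming is read backwards: `f ⇒ g` is the instance of the renamed inference under
  -- `to-entry`, so `Good-⟪⟫⁻` reflects non-triviality to the latter.
  Good-rename : ∀ {f g} → vars f ⊆ vs → vars g ⊆ vs → Good f g → Good (f ⟪ to-position ⟫) (g ⟪ to-position ⟫)
  Good-rename {f} {g} f⊆ g⊆ G = Good-⟪⟫⁻ {to-entry}
    (≡.subst₂ Good (≡.sym (back f⊆)) (≡.sym (back g⊆)) G)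
    (linear {f} f⊆ (linearˡ G)) (linear {g} g⊆ (linearʳ G))
    (ConstantFree-rename _ (cfˡ G)) (ConstantFree-rename _ (cfʳ G))
    (NegationFree-rename _ (nfˡ G)) (NegationFree-rename _ (nfʳ G))
    λ ρ h → ≡.trans (eval-⟪⟫ g _ ρ) (valid G _ (≡.trans (≡.sym (eval-⟪⟫ f _ ρ)) h))

Good-small : ∀ {S : Pred Inference 0ℓ} → S switch → S medial → ∀ {f g} → Good f g → length (vars f) ≤ 4 → D S f g
Good-small {S} sw md {f} {g} G ≤4 =
  ≡.subst₂ (D S) (back f⊆) (back g⊆) (D-⟪⟫ to-entry (≡.subst Linear (≡.sym (back f⊆)) (linearˡ G)) renamed)
  where
  m = length (vars f)
  open Renaming (vars f)
  f⊆ : vars f ⊆ vars f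
  f⊆ = id
  g⊆ : vars g ⊆ vars f
  g⊆ = ↭.∈-resp-↭ (↭-sym (Good-vars G))
  f′ g′ : Formula
  f′ = f ⟪ to-position ⟫
  g′ = g ⟪ to-position ⟫
  G′ : Good f′ g′
  G′ = Good-rename f⊆ g⊆ G
  f′-vars : vars f′ ↭ upTo m
  f′-vars = ⊆-length⇒↭ (Linear⇒Unique (linearˡ G′)) (Unique.upTo⁺ m) f′⊆
    (ℕ.≤-reflexive (≡.trans (length-upTo m) (≡.sym (≡.trans (≡.cong length (vars-rename f _)) (length-map _ (vars f))))))
    where
    f′⊆ : vars f′ ⊆ upTo m
    f′⊆ {x} x∈ with y , y∈ , refl ← ∈-map⁻ (position (vars f)) (≡.subst (x ∈_) (vars-rename f _) x∈) =
      ∈-upTo⁺ (position-< y∈)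
  renamed : D S f′ g′
  renamed with s , eqs ← to-tree (cfˡ G′) (nfˡ G′) | t , eqt ← to-tree (cfʳ G′) (nfʳ G′) =
    ≡.subst₂ (D S) eqs eqt (small-complete sw md ≤4 s t (vs′ eqs) (vt′ eqt) (valid H) (λ x x∈ → nontrivial H (inj₁ x∈)))
    where
    H : Good ⌊ s ⌋ ⌊ t ⌋
    H = ≡.subst₂ Good (≡.sym eqs) (≡.sym eqt) G′
    vs′ : ∀ {h} → h ≡ f′ → vars h ↭ upTo m
    vs′ refl = f′-vars
    vt′ : ∀ {h} → h ≡ g′ → vars h ↭ upTo m
    vt′ refl = ↭-trans (↭-sym (Good-vars G′)) f′-vars

Good⇒L : ∀ {f g} → Good f g → L (length (vars f)) (f ⇒ g)
Good⇒L {f} {g} G = record { premise-linear = linearˡ G ; conclusion-linear = linearʳ G ; valid = valid G }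
  , ↭.↭-length (⊆⊇⇒↭ (deduplicate-! _) (Linear⇒Unique (linearˡ G)) ⊆f (ivars⁺ {f} {g} ∘ inj₁))
  where
  ⊆f : ivars (f ⇒ g) ⊆ vars f
  ⊆f x∈ = [ id , ↭.∈-resp-↭ (↭-sym (Good-vars G)) ]′ (∈-++⁻ (vars f) (∈-deduplicate⁻ _≟_ (vars f ++ vars g) x∈))

switch-linear : LinearInference switch
switch-linear = record
  { premise-linear    = Unique⇒Linear _ (from-yes (unique? (0 ∷ 1 ∷ 2 ∷ [])))
  ; conclusion-linear = Unique⇒Linear _ (from-yes (unique? (0 ∷ 1 ∷ 2 ∷ [])))
  ; valid = λ ρ → sound (ρ 0) (ρ 1) (ρ 2) }
  where
  sound : ∀ x y z → x 𝔹.∧ (y 𝔹.∨ z) ≡ true → (x 𝔹.∧ y) 𝔹.∨ z ≡ true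
  sound true y z h = h

medial-linear : LinearInference medial
medial-linear = record
  { premise-linear    = Unique⇒Linear _ (from-yes (unique? (0 ∷ 1 ∷ 2 ∷ 3 ∷ [])))
  ; conclusion-linear = Unique⇒Linear _ (from-yes (unique? (0 ∷ 2 ∷ 1 ∷ 3 ∷ [])))
  ; valid = λ ρ → sound (ρ 0) (ρ 1) (ρ 2) (ρ 3) }
  where
  sound : ∀ w x y z → (w 𝔹.∧ x) 𝔹.∨ (y 𝔹.∧ z) ≡ true → (w 𝔹.∨ y) 𝔹.∧ (x 𝔹.∨ z) ≡ true
  sound true  true  y    z    _ = refl
  sound true  false true true _ = refl
  sound false x     true true _ = 𝔹ₚ.∨-zeroʳ x

module Family {M : ℕ → List Inference} (family : MinimalFamily M) {n : ℕ} (4≤n : 4 ≤ n) where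
  open MinimalFamily family

  switch∈ : M≤ M n switch
  switch∈ = 3 , ℕ.≤-trans (s≤s (s≤s (s≤s z≤n))) 4≤n , ≡.subst (switch ∈_) (≡.sym M₃) (here refl)

  medial∈ : M≤ M n medial
  medial∈ = 4 , 4≤n , ≡.subst (medial ∈_) (≡.sym M₄) (here refl)

  minimal-rules : ∀ {k} → 4 < k → k ≤ n → ∀ {l r} → ((l ⇒ r) ∈ M k) ⊎ L< k (l ⇒ r) →
    LinearInference (l ⇒ r) ×
    ((M≤ M n (l ⇒ r) × ConstantFreeInf (l ⇒ r) × length (ivars (l ⇒ r)) ≤ k) ⊎ length (ivars (l ⇒ r)) < k)
  minimal-rules {k} 4<k k≤n (inj₁ s∈) with minimal , cf , _ ← M>4 k 4<k
    with lin , len ← All.lookup (Minimal.on-n minimal) s∈ =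
    lin , inj₁ ((k , k≤n , s∈) , All.lookup cf s∈ , ℕ.≤-reflexive len)
  minimal-rules 4<k k≤n (inj₂ (lin , len)) = lin , inj₂ len

  GoodAt : ℕ → Set
  GoodAt k = ∀ {f g} → k ≤ n → Good f g → length (vars f) ≡ k → D (M≤ M n) f g

  Good⇒D : ∀ k → GoodAt k
  Good⇒D = <-rec GoodAt induct
    where
    induct : ∀ k → (∀ {j} → j < k → GoodAt j) → GoodAt k
    induct k rec k≤n G refl with ℕ.≤-<-connex k 4
    ... | inj₁ k≤4 = Good-small switch∈ medial∈ G k≤4
    ... | inj₂ 4<k = Elimination.eliminate (minimal-rules 4<k k≤n)
      (λ H len → rec len (ℕ.≤-trans (ℕ.<⇒≤ len) k≤n) H refl)
      G (Minimal.generates (proj₁ (M>4 k 4<k)) _ (Good⇒L G))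

  rules : ∀ {l r} → M≤ M n (l ⇒ r) → LinearInference (l ⇒ r) ×
    ((M≤ M n (l ⇒ r) × ConstantFreeInf (l ⇒ r) × length (ivars (l ⇒ r)) ≤ n) ⊎ length (ivars (l ⇒ r)) < n)
  rules (0 , _ , s∈) with () ← ≡.subst (_ ∈_) M₀ s∈
  rules (1 , _ , s∈) with () ← ≡.subst (_ ∈_) M₁ s∈
  rules (2 , _ , s∈) with () ← ≡.subst (_ ∈_) M₂ s∈
  -- Switch has three variables, and `4≤n` unfolds to `3 < n`: it counts among the smaller rules and
  -- is derived through `Good⇒D`.
  rules (3 , _ , s∈) with here refl ← ≡.subst (_ ∈_) M₃ s∈ = switch-linear , inj₂ 4≤n
  rules s@(4 , _ , s∈) with here refl ← ≡.subst (_ ∈_) M₄ s∈ =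
    medial-linear , inj₁ (s , (or (and (var 0) (var 1)) (and (var 2) (var 3)) , and (or (var 0) (var 2)) (or (var 1) (var 3))) , 4≤n)
  rules s@(k@(suc (suc (suc (suc (suc _))))) , k≤n , s∈) =
    let (minimal , cf , _) = M>4 k (s≤s (s≤s (s≤s (s≤s (s≤s z≤n))))) ; lin , len = All.lookup (Minimal.on-n minimal) s∈
    in lin , inj₁ (s , All.lookup cf s∈ , ≡.subst (_≤ n) (≡.sym len) k≤n)

theorem6p8 : (M : ℕ → List Inference) → MinimalFamily M →
    (n : ℕ) → 4 ≤ n →
    (r : Inference) → LinearInference r →
    ConstantFreeInf r → NegationFreeInf r → NonTrivial r →
    DerivableWithUnits (M≤ M n) r →
    Derivable (M≤ M n) r
theorem6p8 M family n 4≤n (φ ⇒ ψ) lin (cφ , cψ) (nφ , nψ) nt ds =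
  -- The bound `n` is on the variables of the rules; the inference itself may have any number of
  -- them.
  D⇒Derivable (Elimination.eliminate rules (λ H len → Good⇒D _ (ℕ.<⇒≤ len) H refl) G ds)
  where
  open Family family 4≤n
  eval-[/] : ∀ {χ b} → (∀ ρ → eval ρ χ ≡ b) → ∀ f x ρ → eval ρ (f [ χ / x ]) ≡ eval (ρ [ x ≔ b ]) f
  eval-[/] {χ} {b} h f x ρ = ≡.trans (eval-⟪⟫ f _ ρ) (eval-cong {f} λ {y} _ → at y)
    where
    at : ∀ y → eval ρ (if does (y ≟ x) then χ else var y) ≡ (ρ [ x ≔ b ]) y
    at y with does (y ≟ x)
    ... | true  = h ρ
    ... | false = refl
  G : Good φ ψ
  G = record
    { linearˡ = LinearInference.premise-linear lin ; linearʳ = LinearInference.conclusion-linear lin ; cfˡ = cφ ; cfʳ = cψ ; nfˡ = nφ ; nfʳ = nψ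
    ; valid = LinearInference.valid lin
    ; nontrivial = λ {x} x∈ tr → nt x (ivars⁺ {φ} {ψ} x∈) λ ρ h →
        ≡.trans (eval-[/] (λ _ → refl) ψ x ρ) (tr ρ (≡.trans (≡.sym (eval-[/] (λ _ → refl) φ x ρ)) h)) }
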